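{- $\mathrm{GenSpec}\preceq F_{\mathrm{weak}}$: for all graphs $G,H$, if $F_{\mathrm{weak}}(G)=F_{\mathrm{weak}}(H)$ then $\mathrm{Spec}(G)=\mathrm{Spec}(H)$ and $\mathrm{Spec}(\overline G)=\mathrm{Spec}(\overline H)$, where $\overline G$ denotes the complement graph.
   Context: Graphs are finite, simple and undirected with adjacency matrix $A$. $\mathrm{Spec}(G)$ is the multiset of eigenvalues of $A$. Let $\mu_1<\dots<\mu_m$ be the distinct eigenvalues, $P_i$ the orthogonal projection matrix onto the eigenspace of $\mu_i$, $P_*(x,y)=(P_1(x,y),\dots,P_m(x,y))$. Fürer's weak spectral invariant is $F_{\mathrm{weak}}(G)=\big(\mathrm{Spec}(G),\{\!\{(P_*(x,x),\{\!\{P_*(x,y)\}\!\}_{y\in V(G)})\}\!\}_{x\in V(G)}\big)$, where $\{\!\{\cdot\}\!\}$ denotes a multiset. $\mathrm{GenSpec}(G)=(\mathrm{Spec}(G),\mathrm{Spec}(\overline G))$ (the generalized spectrum). -}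

module Defs where

open import Algebra.Bundles using (CommutativeRing)
open import Algebra.Structures using (IsCommutativeRing)
open import Data.Bool.Base using (Bool; true; false; not; _∧_; if_then_else_)
open import Data.Bool.Properties using (∧-zeroʳ)
import Data.Fin.Base as Fin
open import Data.Fin.Base using (Fin)
open import Data.Fin.Properties using (_≟_)
open import Data.List.Base using (List; filter; length; tabulate)
import Data.List.Relation.Binary.Equality.Setoid as ListEquality
import Data.List.Relation.Binary.Permutation.Setoid as Permutation
open import Data.Nat.Base using (ℕ)
open import Data.Product.Base using (_×_; _,_; ∃; ∃-syntax; Σ-syntax)
open import Data.Product.Relation.Binary.Pointwise.NonDependent using (×-setoid)
open import Data.Vec.Functional using (Vector)
import Data.Vec.Functional.Relation.Binary.Equality.Setoid as VectorEquality
open import Level using (0ℓ)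
open import Relation.Binary.Bundles using (Setoid)
open import Relation.Binary.Construct.StrictToNonStrict using (_≤_)
open import Relation.Binary.Core using (Rel)
open import Relation.Binary.PropositionalEquality.Core
  using (_≡_; refl; sym; cong; cong₂)
open import Relation.Binary.Structures using (IsStrictTotalOrder)
open import Relation.Nullary using (¬_; does; yes; no)
open import Relation.Nullary.Negation using (contradiction)
open import Relation.Unary using (Pred)

-- The real numbers, axiomatised classically as a complete ordered field.
-- Classically there is exactly one model up to isomorphism.  As usual for ℝ
-- in classical mathematics, order and equality are decidable (trichotomy).
record Reals : Set₁ where
  infix  4 _≈ᴿ_ _<_
  infixl 6 _+ᴿ_
  infixl 7 _*ᴿ_
  infix  8 -ᴿ_
  field
    ℝ                  : Set
    _≈ᴿ_ _<_           : Rel ℝ 0ℓ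
    _+ᴿ_ _*ᴿ_          : ℝ → ℝ → ℝ
    -ᴿ_                : ℝ → ℝ
    0ᴿ 1ᴿ              : ℝ
    isCommutativeRing  : IsCommutativeRing _≈ᴿ_ _+ᴿ_ _*ᴿ_ -ᴿ_ 0ᴿ 1ᴿ
    isStrictTotalOrder : IsStrictTotalOrder _≈ᴿ_ _<_
    0<1                : 0ᴿ < 1ᴿ
    +-monoˡ-<          : ∀ {x y} z → x < y → x +ᴿ z < y +ᴿ z
    *-positive         : ∀ {x y} → 0ᴿ < x → 0ᴿ < y → 0ᴿ < x *ᴿ y
    inverse            : ∀ x → ¬ (x ≈ᴿ 0ᴿ) → ∃[ y ] x *ᴿ y ≈ᴿ 1ᴿ

  _≤ᴿ_ : Rel ℝ 0ℓ
  _≤ᴿ_ = _≤_ _≈ᴿ_ _<_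

  IsUpperBound : Pred ℝ 0ℓ → Pred ℝ 0ℓ
  IsUpperBound S b = ∀ x → S x → x ≤ᴿ b

  field
    supremum : (S : Pred ℝ 0ℓ) → ∃ S → ∃ (IsUpperBound S) →
               ∃[ s ] IsUpperBound S s × (∀ b → IsUpperBound S b → s ≤ᴿ b)

  commutativeRing : CommutativeRing 0ℓ 0ℓ
  commutativeRing = record { isCommutativeRing = isCommutativeRing }

record Graph : Set where
  field
    order  : ℕ
    adj    : Fin order → Fin order → Bool
    adj-sym    : ∀ x y → adj x y ≡ adj y x
    adj-irrefl : ∀ x → adj x x ≡ false

  Vertex : Set
  Vertex = Fin order

complement : Graph → Graph
complement G = record
  { order      = order
  ; adj        = coadj
  ; adj-sym    = λ x y → cong₂ _∧_ (cong not (adj-sym x y)) (cong not (≟-sym x y))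
  ; adj-irrefl = coadj-irrefl
  }
  where
  open Graph G

  coadj : Vertex → Vertex → Bool
  coadj x y = not (adj x y) ∧ not (does (x ≟ y))

  ≟-sym : ∀ x y → does (x ≟ y) ≡ does (y ≟ x)
  ≟-sym x y with x ≟ y | y ≟ x
  ... | yes _   | yes _   = refl
  ... | yes x≡y | no  y≢x = contradiction (sym x≡y) y≢x
  ... | no  x≢y | yes y≡x = contradiction (sym y≡x) x≢y
  ... | no  _   | no  _   = refl

  coadj-irrefl : ∀ x → coadj x x ≡ false
  coadj-irrefl x with x ≟ x
  ... | yes _  = ∧-zeroʳ (not (adj x x))
  ... | no x≢x = contradiction refl x≢x

MultisetSetoid : Setoid 0ℓ 0ℓ → Setoid 0ℓ 0ℓ
MultisetSetoid S = Permutation.↭-setoid S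

-- A graph invariant is given by the property that characterises its value
-- on a graph (uniquely, up to the equality of the setoid of values).
record Invariant : Set₁ where
  field
    Value   : Setoid 0ℓ 0ℓ
    IsValue : Graph → Setoid.Carrier Value → Set

-- F(G) = F(H): both values exist, and they are equal.
Agree : Invariant → Graph → Graph → Set
Agree F G H = ∃[ v ] ∃[ w ] IsValue G v × IsValue H w × v ≈ w
  where
  open Invariant F
  open Setoid Value using (_≈_)

module Spectra (R : Reals) where
  open Reals R
  open CommutativeRing commutativeRing
    using (_≈_; _+_; _*_; _-_; 0#; 1#; setoid; semiring)
  open IsStrictTotalOrder isStrictTotalOrder using () renaming (_≟_ to _≟ᴿ_)
  open import Algebra.Properties.Semiring.Sum semiring using (sum)
  open VectorEquality setoid using (_≋_)

  ℝ^_ : ℕ → Set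
  ℝ^ n = Vector ℝ n

  Matrix : ℕ → Set
  Matrix n = Fin n → Fin n → ℝ

  zeroVector : ∀ {n} → ℝ^ n
  zeroVector _ = 0#

  _·_ : ∀ {n} → ℝ^ n → ℝ^ n → ℝ
  v · w = sum λ x → v x * w x

  _*ᵥ_ : ∀ {n} → Matrix n → ℝ^ n → ℝ^ n
  (M *ᵥ v) x = M x · v

  Subspace : ℕ → Set₁
  Subspace n = Pred (ℝ^ n) 0ℓ

  linearCombination : ∀ {n d} → ℝ^ d → (Fin d → ℝ^ n) → ℝ^ n
  linearCombination c b x = sum λ k → c k * b k x

  record IsBasis {n d} (W : Subspace n) (b : Fin d → ℝ^ n) : Set where
    field
      member      : ∀ k → W (b k)
      independent : ∀ c → linearCombination c b ≋ zeroVector → c ≋ zeroVector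
      spanning    : ∀ v → W v → ∃[ c ] v ≋ linearCombination c b

  HasDimension : ∀ {n} → Subspace n → ℕ → Set
  HasDimension {n} W d = Σ[ b ∈ (Fin d → ℝ^ n) ] IsBasis W b

  record IsOrthogonalProjection {n} (W : Subspace n) (P : Matrix n) : Set where
    field
      image      : ∀ v → W (P *ᵥ v)
      orthogonal : ∀ v w → W w → (λ x → v x - (P *ᵥ v) x) · w ≈ 0#

  Eigenspace : ∀ {n} → Matrix n → ℝ → Subspace n
  Eigenspace M μ v = (M *ᵥ v) ≋ (λ x → μ * v x)

  IsEigenvalue : ∀ {n} → Matrix n → ℝ → Set
  IsEigenvalue M μ = ∃[ v ] Eigenspace M μ v × ¬ (v ≋ zeroVector)

  multiplicity : ℝ → List ℝ → ℕ
  multiplicity μ S = length (filter (μ ≟ᴿ_) S)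

  -- For a symmetric real matrix the algebraic multiplicity of μ is the
  -- dimension of its eigenspace.  That dimension is 0, and so μ does not
  -- occur in S, when μ is not an eigenvalue.
  IsSpectrum : ∀ {n} → Matrix n → List ℝ → Set
  IsSpectrum M S = ∀ μ → HasDimension (Eigenspace M μ) (multiplicity μ S)

  -- The distinct eigenvalues μ₁ < … < μₘ of a matrix, and the orthogonal
  -- projections onto their eigenspaces.
  record Eigenprojections {n} (M : Matrix n) : Set where
    field
      m            : ℕ
      μ            : Fin m → ℝ
      μ-increasing : ∀ i j → i Fin.< j → μ i < μ j
      μ-eigenvalue : ∀ i → IsEigenvalue M (μ i)
      μ-exhaustive : ∀ ν → IsEigenvalue M ν → ∃[ i ] ν ≈ μ i
      P            : Fin m → Matrix n
      P-projection : ∀ i → IsOrthogonalProjection (Eigenspace M (μ i)) (P i)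

    -- P_*(x,y), as a list so that tuples of different graphs, whose lengths m
    -- may a priori differ, can be compared.
    P* : Fin n → Fin n → List ℝ
    P* x y = tabulate λ i → P i x y

  adjacencyMatrix : (G : Graph) → Matrix (Graph.order G)
  adjacencyMatrix G x y = if Graph.adj G x y then 1# else 0#

  Spec : Invariant
  Spec = record
    { Value   = MultisetSetoid setoid
    ; IsValue = λ G → IsSpectrum (adjacencyMatrix G)
    }

  TupleSetoid : Setoid 0ℓ 0ℓ
  TupleSetoid = ListEquality.≋-setoid setoid

  ProfileSetoid : Setoid 0ℓ 0ℓ
  ProfileSetoid = MultisetSetoid (×-setoid TupleSetoid (MultisetSetoid TupleSetoid))

  profile : ∀ {n} {M : Matrix n} → Eigenprojections M → Setoid.Carrier ProfileSetoid
  profile E = tabulate λ x → P* x x , tabulate λ y → P* x y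
    where open Eigenprojections E

  Fweak : Invariant
  Fweak = record
    { Value   = ×-setoid (MultisetSetoid setoid) ProfileSetoid
    ; IsValue = λ G (S , T) →
        Invariant.IsValue Spec G S ×
        Σ[ E ∈ Eigenprojections (adjacencyMatrix G) ]
          Setoid._≈_ ProfileSetoid T (profile E)
    }

{-# OPTIONS --safe #-}
module Submission where

-- An eigenvector v of the complement J − I − A for −1 − ν satisfies
-- (A − ν) v = (1·v) 1.  With pᵢ = Pᵢ 1 and βᵢ = 1·pᵢ = |pᵢ|², which is the sum of
-- the entries of Pᵢ and so is read off the weak Fürer invariant, projecting to
-- the eigenspaces W_ν of A shows that the solution space is
--   * of dimension dim W_ν − 1, if ν = μᵢ with βᵢ ≠ 0 (a pole);
--   * of dimension dim W_ν + 1, if ν is not a pole but a root of the secular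
--     equation Σᵢ βᵢ / (μᵢ − ν) = 1 (the extra vector is Σᵢ pᵢ / (μᵢ − ν));
--   * W_ν itself otherwise.
-- Hence the spectrum of the complement depends only on the multiplicities of
-- the μᵢ and on the βᵢ.  The argument needs 1 = Σᵢ pᵢ, that is, the spectral
-- theorem for A: A − Σᵢ μᵢ Pᵢ has no nonzero eigenvalue, hence its Rayleigh
-- quotients have supremum and infimum 0, and it vanishes.

-- `Agree Spec` on the complements asks for a list that is their spectrum, so this list has to be
-- produced. The tools are those of `Reals`: decidable order and suprema of arbitrary predicates.
-- Two points shape the proof. First, the list needs all roots of the secular equation. Each open
-- interval cut out by the μᵢ contains at most one, and a suitable supremum either is that root or
-- shows that there is none; so no continuity, intermediate value theorem or count of roots is
-- involved, and the dimension is found at each real ν separately. Second, the spectral theorem is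
-- reached without compactness of the unit sphere: symmetric elimination yields, for a positive
-- definite form, an explicit constant bounding v·v by a multiple of the form, and this is the gap
-- below a supremum of Rayleigh quotients that is no eigenvalue. No matching of the vertices of the
-- two graphs is constructed: the list is a function of μ, β and the spectrum, and the very same
-- list serves both complements.

open import Defs
open import Algebra.Bundles using (CommutativeRing)
import Algebra.Properties.Ring as RingProperties
import Algebra.Properties.Semiring.Mult.TCOptimised as Multiples
import Algebra.Properties.Semiring.Sum as Sum
import Algebra.Solver.Ring
import Algebra.Solver.Ring.AlmostCommutativeRing as ACR
open import Data.Bool.Base using (true; false; if_then_else_)
import Data.Fin.Base as Fin
open import Data.Fin.Base using (Fin; zero; suc; toℕ; inject₁; punchIn)
open import Data.Fin.Induction using (<-weakInduction)
open import Data.Fin.Properties using (_≟_; <-cmp; all?; any?; toℕ-inject₁)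
open import Data.Integer.Base as ℤ using (ℤ; 0ℤ; 1ℤ)
import Data.Integer.Properties as ℤ
open import Data.List.Base
  using (List; []; _∷_; _++_; [_]; map; filter; length; foldr; tabulate)
open import Data.List.Properties using (filter-accept; filter-reject; filter-++; length-++)
import Data.List.Relation.Binary.Permutation.Setoid.Properties as Permutation
open import Data.List.Relation.Binary.Pointwise.Base using ([]; _∷_)
open import Data.List.Relation.Unary.All using (All; []; _∷_)
open import Data.List.Relation.Unary.All.Properties using (tabulate⁻)
open import Data.Maybe.Base using (Maybe; just; nothing)
import Data.Nat.Base as ℕ
open import Data.Nat.Base using (ℕ; zero; suc; pred)
import Data.Nat.Properties as ℕ
open import Data.Product.Base using (_×_; _,_; proj₁; proj₂; ∃)
open import Data.Product.Relation.Binary.Pointwise.NonDependent using (×-setoid)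
open import Data.Sum.Base using (_⊎_; inj₁; inj₂)
open import Data.Vec.Functional using (tail; insertAt; removeAt) renaming (_∷_ to infixr 5 _◂_)
open import Data.Vec.Functional.Properties using (insertAt-lookup; insertAt-punchIn)
import Data.Vec.Functional.Relation.Binary.Equality.Setoid as VectorEquality
open import Level using (0ℓ)
open import Relation.Binary.Bundles using (Setoid; StrictTotalOrder)
open import Relation.Binary.Definitions using (Tri; tri<; tri≈; tri>; _Respects_)
open import Relation.Binary.PropositionalEquality.Core as ≡ using (_≡_; _≢_)
import Relation.Binary.Reasoning.Setoid as SetoidReasoning
import Relation.Binary.Reasoning.StrictPartialOrder as StrictPartialOrderReasoning
open import Relation.Binary.Structures using (IsStrictTotalOrder)
open import Relation.Nullary using (¬_; Dec; yes; no; does)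
open import Relation.Nullary.Decidable using (_×-dec_; ¬?)
open import Relation.Nullary.Negation using (contradiction)
open import Relation.Unary using (Pred; Decidable)

-- The coefficients are integers because equality of reals does not compute.
module IntegerCoefficientSolver {c ℓ} (R : CommutativeRing c ℓ) where
  open import Data.Integer.Base using (+_; -[1+_]; _⊖_)
  open CommutativeRing R hiding (zero)
  open RingProperties ring
  open Multiples semiring
    using () renaming (_×_ to infixr 8 _⋆_; 1+× to 1+⋆; ×1-homo-* to ⋆1-homo-*; ×-homo-+ to ⋆-homo-+)
  open SetoidReasoning setoid

  -- With the `TCOptimised` multiple, `0 ⋆ 1#` and `1 ⋆ 1#` reduce to `0#` and `1#`, so `con 0ℤ` and
  -- `con 1ℤ` denote these constants definitionally in every later `solve`.
  fromℤ : ℤ → Carrier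
  fromℤ (+ n)    = n ⋆ 1#
  fromℤ -[1+ n ] = - (suc n ⋆ 1#)

  -- `m ⊖ n` steps down in both arguments at once; the induction step inserts `1# - 1#` and gives
  -- one part to each multiple.
  fromℤ-⊖ : ∀ m n → fromℤ (m ⊖ n) ≈ m ⋆ 1# - n ⋆ 1#
  fromℤ-⊖ m       zero    = sym (trans (+-congˡ -0#≈0#) (+-identityʳ _))
  fromℤ-⊖ zero    (suc n) = sym (+-identityˡ _)
  fromℤ-⊖ (suc m) (suc n) = begin
    fromℤ (suc m ⊖ suc n)                  ≡⟨ ≡.cong fromℤ (ℤ.[1+m]⊖[1+n]≡m⊖n m n) ⟩
    fromℤ (m ⊖ n)                          ≈⟨ fromℤ-⊖ m n ⟩
    m ⋆ 1# - n ⋆ 1#                        ≈⟨ +-congʳ (+-identityˡ _) ⟨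
    (0# + m ⋆ 1#) - n ⋆ 1#                 ≈⟨ +-congʳ (+-congʳ (-‿inverseʳ 1#)) ⟨
    ((1# - 1#) + m ⋆ 1#) - n ⋆ 1#          ≈⟨ +-congʳ (trans (+-assoc _ _ _) (trans (+-congˡ (+-comm _ _)) (sym (+-assoc _ _ _)))) ⟩
    ((1# + m ⋆ 1#) - 1#) - n ⋆ 1#          ≈⟨ +-assoc _ _ _ ⟩
    (1# + m ⋆ 1#) + (- 1# - n ⋆ 1#)        ≈⟨ +-cong (1+⋆ m 1#) (trans (-‿cong (1+⋆ n 1#)) (sym (-‿+-comm 1# (n ⋆ 1#)))) ⟨
    suc m ⋆ 1# - suc n ⋆ 1#                ∎

  fromℤ-+ : ∀ i j → fromℤ (i ℤ.+ j) ≈ fromℤ i + fromℤ j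
  fromℤ-+ (+ m)    (+ n)    = ⋆-homo-+ 1# m n
  fromℤ-+ (+ m)    -[1+ n ] = fromℤ-⊖ m (suc n)
  fromℤ-+ -[1+ m ] (+ n)    = trans (fromℤ-⊖ n (suc m)) (+-comm _ _)
  fromℤ-+ -[1+ m ] -[1+ n ] = begin
    - (suc (suc (m ℕ.+ n)) ⋆ 1#)        ≡⟨ ≡.cong (λ k → - (suc k ⋆ 1#)) (≡.sym (ℕ.+-suc m n)) ⟩
    - ((suc m ℕ.+ suc n) ⋆ 1#)          ≈⟨ -‿cong (⋆-homo-+ 1# (suc m) (suc n)) ⟩
    - (suc m ⋆ 1# + suc n ⋆ 1#)         ≈⟨ -‿+-comm _ _ ⟨
    - (suc m ⋆ 1#) - (suc n ⋆ 1#)       ∎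

  fromℤ-neg : ∀ i → fromℤ (ℤ.- i) ≈ - fromℤ i
  fromℤ-neg (+ zero)  = sym -0#≈0#
  fromℤ-neg (+ suc n) = refl
  fromℤ-neg -[1+ n ]  = sym (-‿involutive _)

  fromℤ-+* : ∀ m j → fromℤ (+ m ℤ.* j) ≈ m ⋆ 1# * fromℤ j
  fromℤ-+* m (+ n) = trans (reflexive (≡.cong fromℤ (≡.sym (ℤ.pos-* m n)))) (⋆1-homo-* m n)
  fromℤ-+* m -[1+ n ] = begin
    fromℤ (+ m ℤ.* ℤ.- (+ suc n))      ≡⟨ ≡.cong fromℤ (≡.sym (ℤ.neg-distribʳ-* (+ m) (+ suc n))) ⟩
    fromℤ (ℤ.- (+ m ℤ.* + suc n))      ≈⟨ fromℤ-neg (+ m ℤ.* + suc n) ⟩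
    - fromℤ (+ m ℤ.* + suc n)          ≈⟨ -‿cong (fromℤ-+* m (+ suc n)) ⟩
    - (m ⋆ 1# * suc n ⋆ 1#)            ≈⟨ -‿distribʳ-* _ _ ⟩
    m ⋆ 1# * - (suc n ⋆ 1#)            ∎

  fromℤ-* : ∀ i j → fromℤ (i ℤ.* j) ≈ fromℤ i * fromℤ j
  fromℤ-* (+ m)    j = fromℤ-+* m j
  fromℤ-* -[1+ m ] j = begin
    fromℤ (ℤ.- (+ suc m) ℤ.* j)        ≡⟨ ≡.cong fromℤ (≡.sym (ℤ.neg-distribˡ-* (+ suc m) j)) ⟩
    fromℤ (ℤ.- (+ suc m ℤ.* j))        ≈⟨ fromℤ-neg (+ suc m ℤ.* j) ⟩
    - fromℤ (+ suc m ℤ.* j)            ≈⟨ -‿cong (fromℤ-+* (suc m) j) ⟩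
    - (suc m ⋆ 1# * fromℤ j)           ≈⟨ -‿distribˡ-* _ _ ⟩
    - (suc m ⋆ 1#) * fromℤ j           ∎

  almostCommutativeRing : ACR.AlmostCommutativeRing c ℓ
  almostCommutativeRing = ACR.fromCommutativeRing R

  fromℤ-morphism : ℤ.+-*-rawRing ACR.-Raw-AlmostCommutative⟶ almostCommutativeRing
  fromℤ-morphism = record
    { ⟦_⟧ = fromℤ ; +-homo = fromℤ-+ ; *-homo = fromℤ-* ; -‿homo = fromℤ-neg
    ; 0-homo = refl ; 1-homo = refl }

  fromℤ-≟ : ∀ i j → Maybe (fromℤ i ≈ fromℤ j)
  fromℤ-≟ i j with i ℤ.≟ j
  ... | yes ≡.refl = just refl
  ... | no  _      = nothing

  open Algebra.Solver.Ring ℤ.+-*-rawRing almostCommutativeRing fromℤ-morphism fromℤ-≟ public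
    using (solve; _:=_; _:+_; _:*_; _:-_; :-_; con)


module _ (R : Reals) where
  open Reals R using
    (ℝ; _<_; isStrictTotalOrder; 0<1; +-monoˡ-<; *-positive; inverse;
     _≤ᴿ_; IsUpperBound; supremum; commutativeRing)
  open CommutativeRing commutativeRing hiding (_≉_; isCommutativeRing; zero)
  open RingProperties ring using (-0#≈0#)
  open IntegerCoefficientSolver commutativeRing using (solve; _:=_; _:+_; _:*_; _:-_; :-_; con)
  open Sum semiring
  open VectorEquality setoid using (_≋_)
  open Spectra R

  -- Ordered fields

  strictTotalOrder : StrictTotalOrder _ _ _
  strictTotalOrder = record { isStrictTotalOrder = isStrictTotalOrder }

  open IsStrictTotalOrder isStrictTotalOrder
    using (compare; irrefl; _<?_) renaming (_≟_ to _≟ᴿ_; trans to <-trans)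
  open StrictTotalOrder strictTotalOrder using (strictPartialOrder; <-respʳ-≈; <-respˡ-≈)
  open StrictPartialOrderReasoning strictPartialOrder

  infix 4 _≉_ _≤_
  _≉_ : ℝ → ℝ → Set
  x ≉ y = ¬ (x ≈ y)

  _≤_ : ℝ → ℝ → Set
  _≤_ = _≤ᴿ_

  <⇒≤ : ∀ {x y} → x < y → x ≤ y
  <⇒≤ = inj₁

  ≤-reflexive : ∀ {x y} → x ≈ y → x ≤ y
  ≤-reflexive = inj₂

  ≤-trans : ∀ {x y z} → x ≤ y → y ≤ z → x ≤ z
  ≤-trans {x} {y} {z} p q = begin x ≤⟨ p ⟩ y ≤⟨ q ⟩ z ∎

  ≮⇒≥ : ∀ {x y} → ¬ (x < y) → y ≤ x
  ≮⇒≥ {x} {y} x≮y with compare x y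
  ... | tri< x<y _ _ = contradiction x<y x≮y
  ... | tri≈ _ x≈y _ = inj₂ (sym x≈y)
  ... | tri> _ _ y<x = inj₁ y<x

  ≤⇒≯ : ∀ {x y} → x ≤ y → ¬ (y < x)
  ≤⇒≯ (inj₁ x<y) y<x = irrefl refl (<-trans x<y y<x)
  ≤⇒≯ (inj₂ x≈y) y<x = irrefl (sym x≈y) y<x

  ≤-antisym : ∀ {x y} → x ≤ y → y ≤ x → x ≈ y
  ≤-antisym (inj₁ x<y) y≤x = contradiction x<y (≤⇒≯ y≤x)
  ≤-antisym (inj₂ x≈y) _   = x≈y

  +-monoʳ-< : ∀ {x y} z → x < y → z + x < z + y
  +-monoʳ-< {x} {y} z x<y = begin-strict
    z + x ≈⟨ +-comm z x ⟩
    x + z <⟨ +-monoˡ-< z x<y ⟩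
    y + z ≈⟨ +-comm y z ⟩
    z + y ∎

  +-monoˡ-≤ : ∀ {x y} z → x ≤ y → x + z ≤ y + z
  +-monoˡ-≤ z (inj₁ x<y) = inj₁ (+-monoˡ-< z x<y)
  +-monoˡ-≤ z (inj₂ x≈y) = inj₂ (+-congʳ x≈y)

  +-monoʳ-≤ : ∀ {x y} z → x ≤ y → z + x ≤ z + y
  +-monoʳ-≤ z (inj₁ x<y) = inj₁ (+-monoʳ-< z x<y)
  +-monoʳ-≤ z (inj₂ x≈y) = inj₂ (+-congˡ x≈y)

  +-mono-≤ : ∀ {w x y z} → w ≤ x → y ≤ z → w + y ≤ x + z
  +-mono-≤ {x = x} {y = y} w≤x y≤z = ≤-trans (+-monoˡ-≤ y w≤x) (+-monoʳ-≤ x y≤z)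

  +-nonneg : ∀ {x y} → 0# ≤ x → 0# ≤ y → 0# ≤ x + y
  +-nonneg {x} {y} p q = begin
    0# ≈⟨ +-identityˡ 0# ⟨ 0# + 0# ≤⟨ +-mono-≤ p q ⟩ x + y ∎

  +-pos-nonneg : ∀ {x y} → 0# < x → 0# ≤ y → 0# < x + y
  +-pos-nonneg {x} {y} p q = begin-strict
    0# ≈⟨ +-identityˡ 0# ⟨ 0# + 0# <⟨ +-monoˡ-< 0# p ⟩ x + 0# ≤⟨ +-monoʳ-≤ x q ⟩ x + y ∎

  *-nonneg : ∀ {x y} → 0# ≤ x → 0# ≤ y → 0# ≤ x * y
  *-nonneg (inj₁ p) (inj₁ q) = inj₁ (*-positive p q)
  *-nonneg {x} {y} (inj₂ p) _ = inj₂ (trans (sym (zeroˡ y)) (*-congʳ p))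
  *-nonneg {x} {y} _ (inj₂ q) = inj₂ (trans (sym (zeroʳ x)) (*-congˡ q))

  x<y⇒0<y-x : ∀ {x y} → x < y → 0# < y - x
  x<y⇒0<y-x {x} {y} p = begin-strict
    0# ≈⟨ -‿inverseʳ x ⟨ x - x <⟨ +-monoˡ-< (- x) p ⟩ y - x ∎

  0<y-x⇒x<y : ∀ {x y} → 0# < y - x → x < y
  0<y-x⇒x<y {x} {y} p = begin-strict
    x ≈⟨ +-identityˡ x ⟨ 0# + x <⟨ +-monoˡ-< x p ⟩ y - x + x
      ≈⟨ solve 2 (λ x y → y :- x :+ x := y) refl x y ⟩ y ∎

  x≤y⇒0≤y-x : ∀ {x y} → x ≤ y → 0# ≤ y - x
  x≤y⇒0≤y-x {x} {y} p = begin
    0# ≈⟨ -‿inverseʳ x ⟨ x - x ≤⟨ +-monoˡ-≤ (- x) p ⟩ y - x ∎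

  0≤y-x⇒x≤y : ∀ {x y} → 0# ≤ y - x → x ≤ y
  0≤y-x⇒x≤y {x} {y} p = begin
    x ≈⟨ +-identityˡ x ⟨ 0# + x ≤⟨ +-monoˡ-≤ x p ⟩ y - x + x
      ≈⟨ solve 2 (λ x y → y :- x :+ x := y) refl x y ⟩ y ∎

  x-y≈0⇒x≈y : ∀ {x y} → x - y ≈ 0# → x ≈ y
  x-y≈0⇒x≈y {x} {y} p = begin-equality
    x         ≈⟨ solve 2 (λ x y → x := x :- y :+ y) refl x y ⟩
    x - y + y ≈⟨ +-congʳ p ⟩
    0# + y    ≈⟨ +-identityˡ y ⟩
    y         ∎

  neg⇒0<-x : ∀ {x} → x < 0# → 0# < - x
  neg⇒0<-x {x} p = begin-strict
    0# <⟨ x<y⇒0<y-x p ⟩ 0# - x ≈⟨ +-identityˡ _ ⟩ - x ∎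

  *-neg : ∀ {x y} → x < 0# → y < 0# → 0# < x * y
  *-neg {x} {y} p q = begin-strict
    0# <⟨ *-positive (neg⇒0<-x p) (neg⇒0<-x q) ⟩
    - x * - y ≈⟨ solve 2 (λ x y → :- x :* :- y := x :* y) refl x y ⟩
    x * y ∎

  x≉0⇒0<x² : ∀ {x} → x ≉ 0# → 0# < x * x
  x≉0⇒0<x² {x} x≉0 with compare x 0#
  ... | tri< x<0 _ _ = *-neg x<0 x<0
  ... | tri≈ _ x≈0 _ = contradiction x≈0 x≉0
  ... | tri> _ _ 0<x = *-positive 0<x 0<x

  0≤x² : ∀ x → 0# ≤ x * x
  0≤x² x with x ≟ᴿ 0#
  ... | yes x≈0 = inj₂ (sym (trans (*-congʳ x≈0) (zeroˡ x)))
  ... | no  x≉0 = inj₁ (x≉0⇒0<x² x≉0)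

  *-monoˡ-≤ : ∀ {x y} z → 0# ≤ z → x ≤ y → z * x ≤ z * y
  *-monoˡ-≤ {x} {y} z 0≤z x≤y = 0≤y-x⇒x≤y (begin
    0#            ≤⟨ *-nonneg 0≤z (x≤y⇒0≤y-x x≤y) ⟩
    z * (y - x)   ≈⟨ solve 3 (λ x y z → z :* (y :- x) := z :* y :- z :* x) refl x y z ⟩
    z * y - z * x ∎)

  *-monoʳ-≤ : ∀ {x y} z → 0# ≤ z → x ≤ y → x * z ≤ y * z
  *-monoʳ-≤ {x} {y} z 0≤z x≤y = begin
    x * z ≈⟨ *-comm x z ⟩ z * x ≤⟨ *-monoˡ-≤ z 0≤z x≤y ⟩ z * y ≈⟨ *-comm z y ⟩ y * z ∎

  -- Junk value: 0# ⁻¹ = 0#.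
  infix 9 _⁻¹
  _⁻¹ : ℝ → ℝ
  x ⁻¹ with x ≟ᴿ 0#
  ... | yes _   = 0#
  ... | no  x≉0 = proj₁ (inverse x x≉0)

  *-inverseʳ : ∀ {x} → x ≉ 0# → x * x ⁻¹ ≈ 1#
  *-inverseʳ {x} x≉0 with x ≟ᴿ 0#
  ... | yes x≈0 = contradiction x≈0 x≉0
  ... | no  x≉0 = proj₂ (inverse x x≉0)

  0⁻¹≈0 : ∀ {x} → x ≈ 0# → x ⁻¹ ≈ 0#
  0⁻¹≈0 {x} x≈0 with x ≟ᴿ 0#
  ... | yes _   = refl
  ... | no  x≉0 = contradiction x≈0 x≉0

  *-cancelˡ : ∀ {x y z} → x ≉ 0# → x * y ≈ x * z → y ≈ z
  *-cancelˡ {x} {y} {z} x≉0 p = begin-equality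
    y              ≈⟨ *-identityˡ y ⟨
    1# * y         ≈⟨ *-congʳ (*-inverseʳ x≉0) ⟨
    x * x ⁻¹ * y   ≈⟨ solve 3 (λ x i y → x :* i :* y := i :* (x :* y)) refl x (x ⁻¹) y ⟩
    x ⁻¹ * (x * y) ≈⟨ *-congˡ p ⟩
    x ⁻¹ * (x * z) ≈⟨ solve 3 (λ x i y → x :* i :* y := i :* (x :* y)) refl x (x ⁻¹) z ⟨
    x * x ⁻¹ * z   ≈⟨ *-congʳ (*-inverseʳ x≉0) ⟩
    1# * z         ≈⟨ *-identityˡ z ⟩
    z              ∎

  xy≈0⇒y≈0 : ∀ {x y} → x ≉ 0# → x * y ≈ 0# → y ≈ 0#
  xy≈0⇒y≈0 {x} x≉0 p = *-cancelˡ x≉0 (trans p (sym (zeroʳ x)))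

  x²≈0⇒x≈0 : ∀ {x} → x * x ≈ 0# → x ≈ 0#
  x²≈0⇒x≈0 {x} p with x ≟ᴿ 0#
  ... | yes x≈0 = x≈0
  ... | no  x≉0 = xy≈0⇒y≈0 x≉0 p

  1≉0 : 1# ≉ 0#
  1≉0 1≈0 = irrefl (sym 1≈0) 0<1

  x≉0⇒x⁻¹≉0 : ∀ {x} → x ≉ 0# → x ⁻¹ ≉ 0#
  x≉0⇒x⁻¹≉0 {x} x≉0 p = 1≉0 (trans (sym (*-inverseʳ x≉0)) (trans (*-congˡ p) (zeroʳ x)))

  ⁻¹-unique : ∀ {x y} → x * y ≈ 1# → y ≈ x ⁻¹
  ⁻¹-unique {x} {y} p = *-cancelˡ x≉0 (trans p (sym (*-inverseʳ x≉0)))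
    where
    x≉0 : x ≉ 0#
    x≉0 x≈0 = 1≉0 (trans (sym p) (trans (*-congʳ x≈0) (zeroˡ y)))

  ⁻¹-cong : ∀ {x y} → x ≈ y → x ⁻¹ ≈ y ⁻¹
  ⁻¹-cong {x} {y} x≈y with y ≟ᴿ 0#
  ... | yes y≈0 = 0⁻¹≈0 (trans x≈y y≈0)
  ... | no  y≉0 = sym (⁻¹-unique (trans (*-congʳ x≈y) (proj₂ (inverse y y≉0))))

  -- x⁻¹ has the sign of x because x⁻¹ = (x⁻¹)² x.
  0<x⇒0<x⁻¹ : ∀ {x} → 0# < x → 0# < x ⁻¹
  0<x⇒0<x⁻¹ {x} 0<x = begin-strict
    0#                  <⟨ *-positive (x≉0⇒0<x² (x≉0⇒x⁻¹≉0 x≉0)) 0<x ⟩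
    x ⁻¹ * x ⁻¹ * x     ≈⟨ solve 2 (λ i x → i :* i :* x := i :* (x :* i)) refl (x ⁻¹) x ⟩
    x ⁻¹ * (x * x ⁻¹)   ≈⟨ *-congˡ (*-inverseʳ x≉0) ⟩
    x ⁻¹ * 1#           ≈⟨ *-identityʳ _ ⟩
    x ⁻¹                ∎
    where
    x≉0 : x ≉ 0#
    x≉0 x≈0 = irrefl (sym x≈0) 0<x

  -- Sums and inner products

  sum-cong : ∀ {n} {f g : Fin n → ℝ} → (∀ i → f i ≈ g i) → sum f ≈ sum g
  sum-cong f≈g = sum-cong-≋ f≈g

  sum-zero : ∀ {n} {f : Fin n → ℝ} → (∀ i → f i ≈ 0#) → sum f ≈ 0#
  sum-zero {n} f≈0 = trans (sum-cong f≈0) (sum-replicate-zero n)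

  sum-nonneg : ∀ {n} {f : Fin n → ℝ} → (∀ i → 0# ≤ f i) → 0# ≤ sum f
  sum-nonneg {zero}  _  = inj₂ refl
  sum-nonneg {suc n} 0≤f = +-nonneg (0≤f zero) (sum-nonneg (λ i → 0≤f (suc i)))

  nonneg-sum≈0 : ∀ {n} {f : Fin n → ℝ} → (∀ i → 0# ≤ f i) → sum f ≈ 0# → ∀ i → f i ≈ 0#
  nonneg-sum≈0 {suc n} {f} 0≤f Σf≈0 = λ { zero → head≈0 ; (suc i) → nonneg-sum≈0 (λ i → 0≤f (suc i)) tail≈0 i }
    where
    head≈0 : f zero ≈ 0#
    head≈0 with 0≤f zero
    ... | inj₁ 0<f₀ = contradiction (+-pos-nonneg 0<f₀ (sum-nonneg (λ i → 0≤f (suc i)))) (irrefl (sym Σf≈0))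
    ... | inj₂ 0≈f₀ = sym 0≈f₀
    tail≈0 : sum (λ i → f (suc i)) ≈ 0#
    tail≈0 = trans (sym (+-identityˡ _)) (trans (+-congʳ (sym head≈0)) Σf≈0)

  sum-mono-≤ : ∀ {n} {f g : Fin n → ℝ} → (∀ i → f i ≤ g i) → sum f ≤ sum g
  sum-mono-≤ {zero}  _   = inj₂ refl
  sum-mono-≤ {suc n} f≤g = +-mono-≤ (f≤g zero) (sum-mono-≤ (λ i → f≤g (suc i)))

  sum-*ˡ : ∀ {n} x (f : Fin n → ℝ) → sum (λ i → x * f i) ≈ x * sum f
  sum-*ˡ x f = sym (*-distribˡ-sum x f)

  sum-*ʳ : ∀ {n} x (f : Fin n → ℝ) → sum (λ i → f i * x) ≈ sum f * x
  sum-*ʳ x f = sym (*-distribʳ-sum x f)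

  sum-+ : ∀ {n} (f g : Fin n → ℝ) → sum (λ i → f i + g i) ≈ sum f + sum g
  sum-+ f g = ∑-distrib-+ f g

  sum-neg : ∀ {n} (f : Fin n → ℝ) → sum (λ i → - f i) ≈ - sum f
  sum-neg {zero}  f = sym -0#≈0#
  sum-neg {suc n} f = begin-equality
    - f zero + sum (λ i → - f (suc i)) ≈⟨ +-congˡ (sum-neg (λ i → f (suc i))) ⟩
    - f zero - sum (λ i → f (suc i))   ≈⟨ solve 2 (λ a b → :- a :- b := :- (a :+ b)) refl _ _ ⟩
    - sum f                            ∎

  sum-- : ∀ {n} (f g : Fin n → ℝ) → sum (λ i → f i - g i) ≈ sum f - sum g
  sum-- f g = trans (sum-+ f (λ i → - g i)) (+-congˡ (sum-neg g))

  infixl 6 _⊕_ _⊖_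
  infixr 7 _⊛_
  _⊕_ _⊖_ : ∀ {n} → ℝ^ n → ℝ^ n → ℝ^ n
  (v ⊕ w) x = v x + w x
  (v ⊖ w) x = v x - w x

  _⊛_ : ∀ {n} → ℝ → ℝ^ n → ℝ^ n
  (c ⊛ v) x = c * v x

  ·-cong : ∀ {n} {u u′ v v′ : ℝ^ n} → u ≋ u′ → v ≋ v′ → u · v ≈ u′ · v′
  ·-cong p q = sum-cong λ x → *-cong (p x) (q x)

  ·-congˡ : ∀ {n} {u v v′ : ℝ^ n} → v ≋ v′ → u · v ≈ u · v′
  ·-congˡ q = ·-cong (λ _ → refl) q

  ·-congʳ : ∀ {n} {u u′ v : ℝ^ n} → u ≋ u′ → u · v ≈ u′ · v
  ·-congʳ p = ·-cong p (λ _ → refl)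

  ·-comm : ∀ {n} (u v : ℝ^ n) → u · v ≈ v · u
  ·-comm u v = sum-cong λ x → *-comm (u x) (v x)

  ·-⊕ʳ : ∀ {n} (u v w : ℝ^ n) → u · (v ⊕ w) ≈ u · v + u · w
  ·-⊕ʳ u v w = trans (sum-cong λ x → distribˡ (u x) (v x) (w x)) (sum-+ (λ x → u x * v x) (λ x → u x * w x))

  ·-⊛ʳ : ∀ {n} c (u v : ℝ^ n) → u · (c ⊛ v) ≈ c * (u · v)
  ·-⊛ʳ c u v = trans (sum-cong λ x → solve 3 (λ u c v → u :* (c :* v) := c :* (u :* v)) refl (u x) c (v x)) (sum-*ˡ c (λ x → u x * v x))

  ·-⊖ʳ : ∀ {n} (u v w : ℝ^ n) → u · (v ⊖ w) ≈ u · v - u · w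
  ·-⊖ʳ u v w = trans (sum-cong λ x → solve 3 (λ u v w → u :* (v :- w) := u :* v :- u :* w) refl (u x) (v x) (w x)) (sum-- (λ x → u x * v x) (λ x → u x * w x))

  ·-⊛ˡ : ∀ {n} c (u v : ℝ^ n) → (c ⊛ u) · v ≈ c * (u · v)
  ·-⊛ˡ c u v = trans (·-comm (c ⊛ u) v) (trans (·-⊛ʳ c v u) (*-congˡ (·-comm v u)))

  ·-⊕ˡ : ∀ {n} (u v w : ℝ^ n) → (u ⊕ v) · w ≈ u · w + v · w
  ·-⊕ˡ u v w = trans (·-comm (u ⊕ v) w) (trans (·-⊕ʳ w u v) (+-cong (·-comm w u) (·-comm w v)))

  ·-⊖ˡ : ∀ {n} (u v w : ℝ^ n) → (u ⊖ v) · w ≈ u · w - v · w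
  ·-⊖ˡ u v w = trans (·-comm (u ⊖ v) w) (trans (·-⊖ʳ w u v) (+-cong (·-comm w u) (-‿cong (·-comm w v))))

  ·-zeroʳ : ∀ {n} (u : ℝ^ n) {v} → v ≋ zeroVector → u · v ≈ 0#
  ·-zeroʳ u v≋0 = sum-zero λ x → trans (*-congˡ (v≋0 x)) (zeroʳ (u x))

  ·-linearCombination : ∀ {n d} (u : ℝ^ n) (c : ℝ^ d) (b : Fin d → ℝ^ n) →
                        u · linearCombination c b ≈ sum λ k → c k * (u · b k)
  ·-linearCombination u c b = begin-equality
    sum (λ x → u x * sum (λ k → c k * b k x))   ≈⟨ sum-cong (λ x → *-distribˡ-sum (u x) (λ k → c k * b k x)) ⟩
    sum (λ x → sum (λ k → u x * (c k * b k x))) ≈⟨ ∑-comm (λ x k → u x * (c k * b k x)) ⟩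
    sum (λ k → u · (c k ⊛ b k))                 ≈⟨ sum-cong (λ k → ·-⊛ʳ (c k) u (b k)) ⟩
    sum (λ k → c k * (u · b k))                 ∎

  0≤v·v : ∀ {n} (v : ℝ^ n) → 0# ≤ v · v
  0≤v·v v = sum-nonneg λ x → 0≤x² (v x)

  v·v≈0⇒v≋0 : ∀ {n} (v : ℝ^ n) → v · v ≈ 0# → v ≋ zeroVector
  v·v≈0⇒v≋0 v p x = x²≈0⇒x≈0 (nonneg-sum≈0 (λ x → 0≤x² (v x)) p x)

  v≉0⇒0<v·v : ∀ {n} (v : ℝ^ n) → ¬ (v ≋ zeroVector) → 0# < v · v
  v≉0⇒0<v·v v v≉0 with 0≤v·v v
  ... | inj₁ 0<v·v = 0<v·v
  ... | inj₂ 0≈v·v = contradiction (v·v≈0⇒v≋0 v (sym 0≈v·v)) v≉0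

  _≋0? : ∀ {n} (v : ℝ^ n) → Dec (v ≋ zeroVector)
  v ≋0? = all? λ x → v x ≟ᴿ 0#

  IsSymmetric : ∀ {n} → Matrix n → Set
  IsSymmetric M = ∀ x y → M x y ≈ M y x

  *ᵥ-symmetric : ∀ {n} {M : Matrix n} → IsSymmetric M → ∀ u v → u · (M *ᵥ v) ≈ (M *ᵥ u) · v
  *ᵥ-symmetric {M = M} M-sym u v = begin-equality
    sum (λ x → u x * (M x · v))               ≈⟨ sum-cong (λ x → *-congˡ (·-comm (M x) v)) ⟩
    u · linearCombination v (λ y x → M x y)   ≈⟨ ·-linearCombination u v (λ y x → M x y) ⟩
    sum (λ y → v y * (u · (λ x → M x y)))     ≈⟨ sum-cong (λ y → trans (*-comm _ _) (*-congʳ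
                                                   (trans (·-comm u _) (·-congʳ {v = u} (λ x → M-sym x y))))) ⟩
    (M *ᵥ u) · v                              ∎

  -- Definiteness of quadratic forms

  *-monoʳ-< : ∀ {x y} z → 0# < z → x < y → x * z < y * z
  *-monoʳ-< {x} {y} z 0<z x<y = 0<y-x⇒x<y (begin-strict
    0#            <⟨ *-positive (x<y⇒0<y-x x<y) 0<z ⟩
    (y - x) * z   ≈⟨ solve 3 (λ x y z → (y :- x) :* z := y :* z :- x :* z) refl x y z ⟩
    y * z - x * z ∎)

  *-cancelʳ-≤ : ∀ {x y} z → 0# < z → x * z ≤ y * z → x ≤ y
  *-cancelʳ-≤ z 0<z xz≤yz = ≮⇒≥ λ y<x → ≤⇒≯ xz≤yz (*-monoʳ-< z 0<z y<x)

  *-inverseʳ-pos : ∀ {x} → 0# < x → x * x ⁻¹ ≈ 1#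
  *-inverseʳ-pos 0<x = *-inverseʳ λ x≈0 → irrefl (sym x≈0) 0<x

  δ : ∀ {n} → Matrix n
  δ x y = if does (x ≟ y) then 1# else 0#

  δ-suc : ∀ {n} (x y : Fin n) → δ (suc x) (suc y) ≡ δ x y
  δ-suc x y with x ≟ y
  ... | yes _ = ≡.refl
  ... | no  _ = ≡.refl

  δ-identity : ∀ {n} (v : ℝ^ n) → δ *ᵥ v ≋ v
  δ-identity v zero = begin-equality
    1# * v zero + sum (λ y → 0# * v (suc y)) ≈⟨ +-cong (*-identityˡ _) (sum-zero {f = λ y → 0# * tail v y} λ y → zeroˡ (tail v y)) ⟩
    v zero + 0#                              ≈⟨ +-identityʳ _ ⟩
    v zero                                   ∎
  δ-identity {suc n} v (suc x) = begin-equality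
    0# * v zero + sum (λ y → δ (suc x) (suc y) * tail v y) ≈⟨ +-cong (zeroˡ _) (sum-cong λ y → *-congʳ (reflexive (δ-suc x y))) ⟩
    0# + δ x · tail v                        ≈⟨ +-identityˡ _ ⟩
    δ x · tail v                             ≈⟨ δ-identity (tail v) x ⟩
    v (suc x)                                ∎

  δ-symmetric : ∀ {n} → IsSymmetric (δ {n})
  δ-symmetric x y with x ≟ y | y ≟ x
  ... | yes _   | yes _   = refl
  ... | no  _   | no  _   = refl
  ... | yes x≡y | no  y≢x = contradiction (≡.sym x≡y) y≢x
  ... | no  x≢y | yes y≡x = contradiction (≡.sym y≡x) x≢y

  quadraticForm : ∀ {n} → Matrix n → ℝ^ n → ℝ
  quadraticForm M v = v · (M *ᵥ v)

  quadraticForm-zero : ∀ {n} (M : Matrix n) {v} → v ≋ zeroVector → quadraticForm M v ≈ 0#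
  quadraticForm-zero M {v} v≋0 = trans (·-comm v (M *ᵥ v)) (·-zeroʳ (M *ᵥ v) v≋0)

  -- 0 ≤ |(u·u) v − (u·v) u|² = (u·u) ((u·u)(v·v) − (u·v)²)
  cauchySchwarz : ∀ {n} (u v : ℝ^ n) → (u · v) * (u · v) ≤ (u · u) * (v · v)
  cauchySchwarz u v with 0≤v·v u
  ... | inj₂ 0≈u·u = ≤-reflexive (begin-equality
    (u · v) * (u · v) ≈⟨ *-congʳ (trans (·-comm u v) (·-zeroʳ v (v·v≈0⇒v≋0 u (sym 0≈u·u)))) ⟩
    0# * (u · v)      ≈⟨ zeroˡ _ ⟩
    0#                ≈⟨ zeroˡ _ ⟨
    0# * (v · v)      ≈⟨ *-congʳ 0≈u·u ⟩
    (u · u) * (v · v) ∎)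
  ... | inj₁ 0<u·u = *-cancelʳ-≤ (u · u) 0<u·u (0≤y-x⇒x≤y (begin
    0# ≤⟨ 0≤v·v w ⟩
    w · w ≈⟨ ·-⊖ˡ ((u · u) ⊛ v) ((u · v) ⊛ u) w ⟩
    ((u · u) ⊛ v) · w - ((u · v) ⊛ u) · w ≈⟨ +-cong (expand v) (-‿cong (expand′ u)) ⟩
    (u · u) * ((u · u) * (v · v) - (u · v) * (v · u)) - (u · v) * ((u · u) * (u · v) - (u · v) * (u · u))
      ≈⟨ +-congʳ (*-congˡ (+-congˡ (-‿cong (*-congˡ (·-comm v u))))) ⟩
    (u · u) * ((u · u) * (v · v) - (u · v) * (u · v)) - (u · v) * ((u · u) * (u · v) - (u · v) * (u · u))
      ≈⟨ solve 3 (λ a b l → a :* (a :* b :- l :* l) :- l :* (a :* l :- l :* a) := a :* b :* a :- l :* l :* a) refl (u · u) (v · v) (u · v) ⟩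
    (u · u) * (v · v) * (u · u) - (u · v) * (u · v) * (u · u) ∎))
    where
    w : ℝ^ _
    w = (u · u) ⊛ v ⊖ (u · v) ⊛ u
    pairing : ∀ z → z · w ≈ (u · u) * (z · v) - (u · v) * (z · u)
    pairing z = trans (·-⊖ʳ z ((u · u) ⊛ v) ((u · v) ⊛ u)) (+-cong (·-⊛ʳ (u · u) z v) (-‿cong (·-⊛ʳ (u · v) z u)))
    expand : ∀ z → ((u · u) ⊛ z) · w ≈ (u · u) * ((u · u) * (z · v) - (u · v) * (z · u))
    expand z = trans (·-⊛ˡ (u · u) z w) (*-congˡ (pairing z))
    expand′ : ∀ z → ((u · v) ⊛ z) · w ≈ (u · v) * ((u · u) * (z · v) - (u · v) * (z · u))
    expand′ z = trans (·-⊛ˡ (u · v) z w) (*-congˡ (pairing z))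

  u·v≤u·u+v·v : ∀ {n} (u v : ℝ^ n) → u · v ≤ u · u + v · v
  u·v≤u·u+v·v u v with compare (u · v) 0#
  ... | tri< u·v<0 _ _ = ≤-trans (<⇒≤ u·v<0) (+-nonneg (0≤v·v u) (0≤v·v v))
  ... | tri≈ _ u·v≈0 _ = ≤-trans (≤-reflexive u·v≈0) (+-nonneg (0≤v·v u) (0≤v·v v))
  ... | tri> _ _ 0<u·v = 0≤y-x⇒x≤y (begin
    0# ≤⟨ +-nonneg (0≤v·v (u ⊖ v)) (<⇒≤ 0<u·v) ⟩
    (u ⊖ v) · (u ⊖ v) + u · v ≈⟨ +-congʳ (trans (·-⊖ˡ u v (u ⊖ v)) (+-cong (·-⊖ʳ u u v) (-‿cong (·-⊖ʳ v u v)))) ⟩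
    (u · u - u · v) - (v · u - v · v) + u · v ≈⟨ +-congʳ (+-congˡ (-‿cong (+-congʳ (·-comm v u)))) ⟩
    (u · u - u · v) - (u · v - v · v) + u · v ≈⟨ solve 3 (λ a b l → (a :- l) :- (l :- b) :+ l := a :+ b :- l) refl (u · u) (v · v) (u · v) ⟩
    u · u + v · v - u · v ∎)

  -- Any constant would do: it only makes the Rayleigh quotients bounded above. This one, 1 plus the
  -- squared Frobenius norm, comes from applying Cauchy-Schwarz to each row.
  quadraticForm-bounded : ∀ {n} (M : Matrix n) v →
                          quadraticForm M v ≤ (1# + sum λ x → M x · M x) * (v · v)
  quadraticForm-bounded M v = begin
    v · (M *ᵥ v)                            ≤⟨ u·v≤u·u+v·v v (M *ᵥ v) ⟩
    v · v + (M *ᵥ v) · (M *ᵥ v)             ≤⟨ +-monoʳ-≤ (v · v) (sum-mono-≤ λ x → cauchySchwarz (M x) v) ⟩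
    v · v + sum (λ x → (M x · M x) * (v · v)) ≈⟨ +-cong (sym (*-identityˡ (v · v))) (sum-*ʳ (v · v) (λ x → M x · M x)) ⟩
    1# * (v · v) + sum (λ x → M x · M x) * (v · v) ≈⟨ distribʳ (v · v) 1# _ ⟨
    (1# + sum λ x → M x · M x) * (v · v)    ∎

  -- Positive definiteness is recorded with a uniform constant, the role usually played by a minimum
  -- over the unit sphere. The alternatives may overlap; what matters is that one of them can always
  -- be exhibited with its witness.
  data Definiteness {n} (N : Matrix n) : Set where
    singular : ∀ v → ¬ (v ≋ zeroVector) → N *ᵥ v ≋ zeroVector → Definiteness N
    negative : ∀ v → quadraticForm N v < 0# → Definiteness N
    coercive : ∀ c → 0# ≤ c → (∀ v → 0# ≤ quadraticForm N v) →
               (∀ v → v · v ≤ c * quadraticForm N v) → Definiteness N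

  -- Symmetric elimination of one variable

  module Blocks {n} (N : Matrix (suc n)) (N-sym : IsSymmetric N) where
    a : ℝ
    a = N zero zero

    b : ℝ^ n
    b i = N (suc i) zero

    minor : Matrix n
    minor i j = N (suc i) (suc j)

    minor-sym : IsSymmetric minor
    minor-sym i j = N-sym (suc i) (suc j)

    head-row : ∀ w → (N *ᵥ w) zero ≈ a * w zero + b · tail w
    head-row w = +-congˡ (·-congʳ {v = tail w} λ j → N-sym zero (suc j))

    expansion : ∀ w → let t = w zero; v = tail w in
                quadraticForm N w ≈ a * (t * t) + (t * (b · v) + t * (b · v)) + quadraticForm minor v
    expansion w = begin-equality
      t * (N *ᵥ w) zero + v · (λ i → b i * t + (minor *ᵥ v) i)
        ≈⟨ +-cong (*-congˡ (head-row w)) (·-congˡ {u = v} λ i → +-congʳ (*-comm (b i) t)) ⟩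
      t * (a * t + b · v) + v · (t ⊛ b ⊕ minor *ᵥ v)
        ≈⟨ +-congˡ (trans (·-⊕ʳ v (t ⊛ b) (minor *ᵥ v)) (+-congʳ (trans (·-⊛ʳ t v b) (*-congˡ (·-comm v b))))) ⟩
      t * (a * t + b · v) + (t * (b · v) + quadraticForm minor v)
        ≈⟨ solve 4 (λ a t l q → t :* (a :* t :+ l) :+ (t :* l :+ q) := a :* (t :* t) :+ (t :* l :+ t :* l) :+ q)
             refl a t (b · v) (quadraticForm minor v) ⟩
      a * (t * t) + (t * (b · v) + t * (b · v)) + quadraticForm minor v ∎
      where
      t = w zero
      v = tail w

    schur : Matrix n
    schur i j = minor i j - a ⁻¹ * (b i * b j)

    schur-sym : IsSymmetric schur
    schur-sym i j = +-cong (minor-sym i j) (-‿cong (*-congˡ (*-comm (b i) (b j))))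

    schur-*ᵥ : ∀ v → schur *ᵥ v ≋ minor *ᵥ v ⊖ (a ⁻¹ * (b · v)) ⊛ b
    schur-*ᵥ v i = begin-equality
      schur i · v ≈⟨ ·-⊖ˡ (minor i) (λ j → a ⁻¹ * (b i * b j)) v ⟩
      minor i · v - (λ j → a ⁻¹ * (b i * b j)) · v
        ≈⟨ +-congˡ (-‿cong (trans (·-⊛ˡ (a ⁻¹) (b i ⊛ b) v) (*-congˡ (·-⊛ˡ (b i) b v)))) ⟩
      minor i · v - a ⁻¹ * (b i * (b · v))
        ≈⟨ +-congˡ (-‿cong (solve 3 (λ g b l → g :* (b :* l) := g :* l :* b) refl (a ⁻¹) (b i) (b · v))) ⟩
      (minor *ᵥ v ⊖ (a ⁻¹ * (b · v)) ⊛ b) i ∎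

    schur-form : ∀ v → quadraticForm schur v ≈ quadraticForm minor v - a ⁻¹ * (b · v) * (b · v)
    schur-form v = begin-equality
      v · (schur *ᵥ v)                                ≈⟨ ·-congˡ {u = v} (schur-*ᵥ v) ⟩
      v · (minor *ᵥ v ⊖ (a ⁻¹ * (b · v)) ⊛ b)         ≈⟨ ·-⊖ʳ v (minor *ᵥ v) ((a ⁻¹ * (b · v)) ⊛ b) ⟩
      quadraticForm minor v - v · ((a ⁻¹ * (b · v)) ⊛ b) ≈⟨ +-congˡ (-‿cong (trans (·-⊛ʳ (a ⁻¹ * (b · v)) v b) (*-congˡ (·-comm v b)))) ⟩
      quadraticForm minor v - a ⁻¹ * (b · v) * (b · v) ∎

    completeSquare : a ≉ 0# → ∀ w → let s = w zero + a ⁻¹ * (b · tail w) in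
                     quadraticForm N w ≈ a * (s * s) + quadraticForm schur (tail w)
    completeSquare a≉0 w = begin-equality
      quadraticForm N w ≈⟨ expansion w ⟩
      a * (t * t) + (t * l + t * l) + q
        ≈⟨ +-congʳ (+-congˡ (trans (sym (*-identityˡ _)) (*-congʳ (sym (*-inverseʳ a≉0))))) ⟩
      a * (t * t) + a * g * (t * l + t * l) + q
        ≈⟨ solve 5 (λ a t l q g → a :* (t :* t) :+ a :* g :* (t :* l :+ t :* l) :+ q
                      := a :* ((t :+ g :* l) :* (t :+ g :* l)) :+ (q :- a :* g :* (g :* l :* l))) refl a t l q g ⟩
      a * ((t + g * l) * (t + g * l)) + (q - a * g * (g * l * l))
        ≈⟨ +-congˡ (+-congˡ (-‿cong (trans (*-congʳ (*-inverseʳ a≉0)) (*-identityˡ _)))) ⟩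
      a * ((t + g * l) * (t + g * l)) + (q - g * l * l)
        ≈⟨ +-congˡ (schur-form (tail w)) ⟨
      a * ((t + g * l) * (t + g * l)) + quadraticForm schur (tail w) ∎
      where
      t = w zero
      l = b · tail w
      q = quadraticForm minor (tail w)
      g = a ⁻¹

    -- The head is chosen to make the square in `completeSquare` vanish.
    lift : ℝ^ n → ℝ^ suc n
    lift v = - (a ⁻¹ * (b · v)) ◂ v

    lift-form : a ≉ 0# → ∀ v → quadraticForm N (lift v) ≈ quadraticForm schur v
    lift-form a≉0 v = trans (completeSquare a≉0 (lift v)) (begin-equality
      a * ((- x + x) * (- x + x)) + quadraticForm schur v
        ≈⟨ +-congʳ (solve 2 (λ a x → a :* ((:- x :+ x) :* (:- x :+ x)) := con 0ℤ) refl a x) ⟩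
      0# + quadraticForm schur v ≈⟨ +-identityˡ _ ⟩
      quadraticForm schur v ∎)
      where
      x = a ⁻¹ * (b · v)

    lift-kernel : a ≉ 0# → ∀ v → schur *ᵥ v ≋ zeroVector → N *ᵥ lift v ≋ zeroVector
    lift-kernel a≉0 v _ zero = begin-equality
      (N *ᵥ lift v) zero               ≈⟨ head-row (lift v) ⟩
      a * - (a ⁻¹ * (b · v)) + b · v   ≈⟨ solve 3 (λ a g l → a :* :- (g :* l) :+ l := l :- a :* g :* l) refl a (a ⁻¹) (b · v) ⟩
      b · v - a * a ⁻¹ * (b · v)       ≈⟨ +-congˡ (-‿cong (trans (*-congʳ (*-inverseʳ a≉0)) (*-identityˡ _))) ⟩
      b · v - b · v                    ≈⟨ -‿inverseʳ _ ⟩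
      0#                               ∎
    lift-kernel a≉0 v p (suc i) = begin-equality
      b i * - (a ⁻¹ * (b · v)) + (minor *ᵥ v) i ≈⟨ solve 3 (λ b x m → b :* :- x :+ m := m :- x :* b) refl (b i) (a ⁻¹ * (b · v)) ((minor *ᵥ v) i) ⟩
      (minor *ᵥ v ⊖ (a ⁻¹ * (b · v)) ⊛ b) i     ≈⟨ schur-*ᵥ v i ⟨
      (schur *ᵥ v) i                            ≈⟨ p i ⟩
      0#                                        ∎

    -- Let g = a⁻¹, l = b·v, s = t + g l, and let y be the Schur form at v. From t = s - g l follows
    -- t² ≤ 2s² + 2g² l², and Cauchy-Schwarz replaces l² by (b·b)(v·v). With h = 2g²(b·b) + 1 this
    -- leaves 2s² + h (v·v) ≤ 2g (a s²) + h c y. Both a s² and y are nonnegative, so the sum of the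
    -- two coefficients `c₁` and `c₂` bounds everything by a multiple of a s² + y.
    coercive-step : 0# < a → ∀ c → 0# ≤ c → (∀ v → 0# ≤ quadraticForm schur v) →
                    (∀ v → v · v ≤ c * quadraticForm schur v) → Definiteness N
    coercive-step 0<a c 0≤c 0≤schur bound = coercive (c₁ + c₂) (+-nonneg 0≤c₁ 0≤c₂)
      (λ w → ≤-trans (+-nonneg (as² w) (0≤schur (tail w))) (≤-reflexive (sym (completeSquare a≉0 w))))
      (λ w → let t = w zero; v = tail w; l = b · v; s = t + g * l; y = quadraticForm schur v in begin
        t * t + v · v
          ≤⟨ +-monoˡ-≤ (v · v) (0≤y-x⇒x≤y (begin
               0# ≤⟨ 0≤x² (s + g * l) ⟩
               (s + g * l) * (s + g * l)
                 ≈⟨ solve 3 (λ t g l → let s = t :+ g :* l in (s :+ g :* l) :* (s :+ g :* l)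
                      := s :* s :+ s :* s :+ (g :* g :+ g :* g) :* (l :* l) :- t :* t) refl t g l ⟩
               s * s + s * s + (g * g + g * g) * (l * l) - t * t ∎)) ⟩
        s * s + s * s + (g * g + g * g) * (l * l) + v · v
          ≤⟨ +-monoˡ-≤ (v · v) (+-monoʳ-≤ (s * s + s * s) (*-monoˡ-≤ _ 0≤2g² (cauchySchwarz b v))) ⟩
        s * s + s * s + (g * g + g * g) * ((b · b) * (v · v)) + v · v
          ≈⟨ solve 4 (λ s h b v → s :* s :+ s :* s :+ h :* (b :* v) :+ v := s :* s :+ s :* s :+ (h :* b :+ con 1ℤ) :* v)
               refl s (g * g + g * g) (b · b) (v · v) ⟩
        s * s + s * s + h * (v · v)
          ≤⟨ +-monoʳ-≤ (s * s + s * s) (*-monoˡ-≤ h 0≤h (bound v)) ⟩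
        s * s + s * s + h * (c * y)
          ≈⟨ +-cong (trans (sym (*-identityˡ _)) (*-congʳ (sym (*-inverseʳ a≉0)))) (sym (*-assoc h c y)) ⟩
        a * g * (s * s + s * s) + c₂ * y
          ≈⟨ +-congʳ (solve 3 (λ a g s → a :* g :* (s :* s :+ s :* s) := (g :+ g) :* (a :* (s :* s))) refl a g s) ⟩
        c₁ * (a * (s * s)) + c₂ * y
          ≤⟨ 0≤y-x⇒x≤y (≤-trans (+-nonneg (*-nonneg 0≤c₂ (as² w)) (*-nonneg 0≤c₁ (0≤schur v)))
               (≤-reflexive (solve 4 (λ p q x y → q :* x :+ p :* y := (p :+ q) :* (x :+ y) :- (p :* x :+ q :* y))
                  refl c₁ c₂ (a * (s * s)) y))) ⟩
        (c₁ + c₂) * (a * (s * s) + y) ≈⟨ *-congˡ (completeSquare a≉0 w) ⟨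
        (c₁ + c₂) * quadraticForm N w ∎)
      where
      a≉0 : a ≉ 0#
      a≉0 a≈0 = irrefl (sym a≈0) 0<a
      g = a ⁻¹
      h = (g * g + g * g) * (b · b) + 1#
      c₁ = g + g
      c₂ = h * c
      0≤c₁ : 0# ≤ c₁
      0≤c₁ = +-nonneg (<⇒≤ (0<x⇒0<x⁻¹ 0<a)) (<⇒≤ (0<x⇒0<x⁻¹ 0<a))
      0≤2g² : 0# ≤ g * g + g * g
      0≤2g² = +-nonneg (0≤x² g) (0≤x² g)
      0≤h : 0# ≤ h
      0≤h = +-nonneg (*-nonneg 0≤2g² (0≤v·v b)) (<⇒≤ 0<1)
      0≤c₂ : 0# ≤ c₂
      0≤c₂ = *-nonneg 0≤h 0≤c
      as² : ∀ w → 0# ≤ a * ((w zero + g * (b · tail w)) * (w zero + g * (b · tail w)))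
      as² w = *-nonneg (<⇒≤ 0<a) (0≤x² _)

    -- If b = 0, the first unit vector lies in the kernel. Otherwise the form at (t, b) is affine in
    -- t, namely 2t (b·b) + q with q the form of `minor` at b, and t = -(q + 1) / (2 b·b) gives it
    -- the value -1.
    zero-pivot : a ≈ 0# → Definiteness N
    zero-pivot a≈0 with b ≋0?
    ... | yes b≋0 = singular (1# ◂ zeroVector) (λ p → 1≉0 (p zero))
      λ { zero → trans (head-row (1# ◂ zeroVector)) (trans (+-cong (trans (*-congʳ a≈0) (zeroˡ _)) (·-zeroʳ b (λ _ → refl))) (+-identityˡ _))
        ; (suc i) → trans (+-cong (trans (*-congʳ (b≋0 i)) (zeroˡ _)) (·-zeroʳ (minor i) (λ _ → refl))) (+-identityˡ _) }
    ... | no b≉0 = negative (t ◂ b) (begin-strict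
      quadraticForm N (t ◂ b) ≈⟨ expansion (t ◂ b) ⟩
      a * (t * t) + (t * (b · b) + t * (b · b)) + q ≈⟨ +-congʳ (+-congʳ (trans (*-congʳ a≈0) (zeroˡ _))) ⟩
      0# + (t * (b · b) + t * (b · b)) + q
        ≈⟨ solve 3 (λ q h b → con 0ℤ :+ (:- ((q :+ con 1ℤ) :* h) :* b :+ :- ((q :+ con 1ℤ) :* h) :* b) :+ q
             := q :- (q :+ con 1ℤ) :* ((b :+ b) :* h)) refl q h (b · b) ⟩
      q - (q + 1#) * ((b · b + b · b) * h) ≈⟨ +-congˡ (-‿cong (trans (*-congˡ (*-inverseʳ-pos 0<2b²)) (*-identityʳ _))) ⟩
      q - (q + 1#) ≈⟨ solve 1 (λ q → q :- (q :+ con 1ℤ) := :- con 1ℤ) refl q ⟩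
      - 1# <⟨ 0<y-x⇒x<y (<-respʳ-≈ (solve 0 (con 1ℤ := con 0ℤ :- (:- con 1ℤ)) refl) 0<1) ⟩
      0# ∎)
      where
      q = quadraticForm minor b
      h = (b · b + b · b) ⁻¹
      t = - ((q + 1#) * h)
      0<2b² : 0# < b · b + b · b
      0<2b² = +-pos-nonneg (v≉0⇒0<v·v b b≉0) (0≤v·v b)

  -- The sign of the pivot decides: a negative or zero pivot gives a witness at once, and a positive
  -- one passes the question to the Schur complement, whose witnesses lift.
  definiteness : ∀ {n} (N : Matrix n) → IsSymmetric N → Definiteness N
  definiteness {zero} N _ = coercive 0# (≤-reflexive refl) (λ _ → ≤-reflexive refl)
                                        (λ _ → ≤-reflexive (sym (zeroˡ 0#)))
  definiteness {suc n} N N-sym = pivot (compare a 0#)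
    where
    open Blocks N N-sym
    pivot : _ → Definiteness N
    pivot (tri< a<0 _ _) = negative (1# ◂ zeroVector) (begin-strict
      quadraticForm N (1# ◂ zeroVector) ≈⟨ expansion (1# ◂ zeroVector) ⟩
      a * (1# * 1#) + (1# * (b · zeroVector) + 1# * (b · zeroVector)) + quadraticForm minor zeroVector
        ≈⟨ +-cong (+-cong (trans (*-congˡ (*-identityˡ 1#)) (*-identityʳ a)) (trans (+-cong z z) (+-identityˡ 0#))) (quadraticForm-zero minor (λ _ → refl)) ⟩
      a + 0# + 0# ≈⟨ trans (+-identityʳ _) (+-identityʳ _) ⟩
      a <⟨ a<0 ⟩
      0# ∎)
      where
      z : 1# * (b · zeroVector) ≈ 0#
      z = trans (*-identityˡ _) (·-zeroʳ b (λ _ → refl))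
    pivot (tri≈ _ a≈0 _) = zero-pivot a≈0
    pivot (tri> _ a≉0 0<a) with definiteness schur schur-sym
    ... | singular v v≉0 p = singular (lift v) (λ q → v≉0 (λ i → q (suc i))) (lift-kernel a≉0 v p)
    ... | negative v p     = negative (lift v) (<-respˡ-≈ (sym (lift-form a≉0 v)) p)
    ... | coercive c 0≤c 0≤schur bound = coercive-step 0<a c 0≤c 0≤schur bound

  -- The supremum s of the Rayleigh quotients of M must be an eigenvalue:
  -- otherwise s − M is coercive, and s is not the least upper bound.
  module _ {n} (M : Matrix n) (M-sym : IsSymmetric M)
           (noPositiveEigenvalue : ∀ s v → 0# < s → M *ᵥ v ≋ s ⊛ v → v ≋ zeroVector) where
    private
      -- All t not exceeding some Rayleigh quotient, multiplied out so that membership involves no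
      -- division.
      Rayleigh : ℝ → Set
      Rayleigh t = ∃ λ v → 0# < v · v × t * (v · v) ≤ quadraticForm M v

      quotient : ∀ v → 0# < v · v → Rayleigh (quadraticForm M v * (v · v) ⁻¹)
      quotient v 0<v·v = v , 0<v·v , ≤-reflexive (begin-equality
        q * (v · v) ⁻¹ * (v · v)   ≈⟨ solve 3 (λ q i v → q :* i :* v := v :* i :* q) refl q ((v · v) ⁻¹) (v · v) ⟩
        (v · v) * (v · v) ⁻¹ * q   ≈⟨ *-congʳ (*-inverseʳ-pos 0<v·v) ⟩
        1# * q                     ≈⟨ *-identityˡ q ⟩
        q                          ∎)
        where q = quadraticForm M v

      nonzero-form⇒0<v·v : ∀ {N : Matrix n} v → quadraticForm N v ≉ 0# → 0# < v · v
      nonzero-form⇒0<v·v {N} v q≉0 = v≉0⇒0<v·v v λ v≋0 → q≉0 (quadraticForm-zero N v≋0)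

    quadraticForm-nonpositive : ∀ v → quadraticForm M v ≤ 0#
    quadraticForm-nonpositive v₀ = ≮⇒≥ absurd
      where
      absurd : ¬ (0# < quadraticForm M v₀)
      absurd 0<q₀ = finish (definiteness N N-sym)
        where
        0<v₀·v₀ : 0# < v₀ · v₀
        0<v₀·v₀ = nonzero-form⇒0<v·v {M} v₀ λ q≈0 → irrefl (sym q≈0) 0<q₀
        sup = supremum Rayleigh (_ , quotient v₀ 0<v₀·v₀)
          (_ , λ { t (v , 0<v·v , p) → *-cancelʳ-≤ (v · v) 0<v·v (≤-trans p (quadraticForm-bounded M v)) })
        s = proj₁ sup
        s-upper : IsUpperBound Rayleigh s
        s-upper = proj₁ (proj₂ sup)
        s-least : ∀ b → IsUpperBound Rayleigh b → s ≤ b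
        s-least = proj₂ (proj₂ sup)
        0<s : 0# < s
        0<s = begin-strict
          0# <⟨ *-positive 0<q₀ (0<x⇒0<x⁻¹ 0<v₀·v₀) ⟩
          quadraticForm M v₀ * (v₀ · v₀) ⁻¹ ≤⟨ s-upper _ (quotient v₀ 0<v₀·v₀) ⟩
          s ∎
        N : Matrix n
        N x y = s * δ x y - M x y
        N-sym : IsSymmetric N
        N-sym x y = +-cong (*-congˡ (δ-symmetric x y)) (-‿cong (M-sym x y))
        N-*ᵥ : ∀ v → N *ᵥ v ≋ s ⊛ v ⊖ M *ᵥ v
        N-*ᵥ v x = trans (·-⊖ˡ (s ⊛ δ x) (M x) v) (+-congʳ (trans (·-⊛ˡ s (δ x) v) (*-congˡ (δ-identity v x))))
        N-form : ∀ v → quadraticForm N v ≈ s * (v · v) - quadraticForm M v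
        N-form v = trans (·-congˡ {u = v} (N-*ᵥ v)) (trans (·-⊖ʳ v (s ⊛ v) (M *ᵥ v)) (+-congʳ (·-⊛ʳ s v v)))

        finish : ¬ Definiteness N
        finish (singular v v≉0 p) = v≉0 (noPositiveEigenvalue s v 0<s λ x →
          sym (begin-equality
            s * v x ≈⟨ solve 2 (λ a b → a := a :- b :+ b) refl (s * v x) ((M *ᵥ v) x) ⟩
            s * v x - (M *ᵥ v) x + (M *ᵥ v) x ≈⟨ +-congʳ (trans (sym (N-*ᵥ v x)) (p x)) ⟩
            0# + (M *ᵥ v) x ≈⟨ +-identityˡ _ ⟩
            (M *ᵥ v) x ∎))
        finish (negative v p) = ≤⇒≯ (begin
          0#                                ≤⟨ x≤y⇒0≤y-x t*v²≤s*v² ⟩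
          s * (v · v) - quadraticForm M v   ≈⟨ N-form v ⟨
          quadraticForm N v                 ∎) p
          where
          0<v·v : 0# < v · v
          0<v·v = nonzero-form⇒0<v·v {N} v λ q≈0 → irrefl q≈0 p
          t = quadraticForm M v * (v · v) ⁻¹
          t*v²≤s*v² : quadraticForm M v ≤ s * (v · v)
          t*v²≤s*v² = begin
            quadraticForm M v ≈⟨ *-identityˡ _ ⟨
            1# * quadraticForm M v ≈⟨ *-congʳ (*-inverseʳ-pos 0<v·v) ⟨
            (v · v) * (v · v) ⁻¹ * quadraticForm M v
              ≈⟨ solve 3 (λ q i v → q :* i :* v := v :* i :* q) refl (quadraticForm M v) ((v · v) ⁻¹) (v · v) ⟨
            t * (v · v) ≤⟨ *-monoʳ-≤ (v · v) (<⇒≤ 0<v·v) (s-upper t (quotient v 0<v·v)) ⟩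
            s * (v · v) ∎
        -- From v·v ≤ c q ≤ (1 + c) q, with q the form of `N`, the smaller number s - e is an upper
        -- bound too, where e = 1/(1 + c). The summand 1 keeps the divisor positive, since c may be
        -- 0.
        finish (coercive c 0≤c 0≤N bound) = ≤⇒≯ (s-least (s - e) upper) (0<y-x⇒x<y (begin-strict
          0# <⟨ 0<x⇒0<x⁻¹ 0<d ⟩
          e  ≈⟨ solve 2 (λ s e → e := s :- (s :- e)) refl s e ⟩
          s - (s - e) ∎))
          where
          d = 1# + c
          0<d : 0# < d
          0<d = +-pos-nonneg 0<1 0≤c
          e = d ⁻¹
          ev²≤N : ∀ v → e * (v · v) ≤ quadraticForm N v
          ev²≤N v = *-cancelʳ-≤ d 0<d (begin
            e * (v · v) * d   ≈⟨ solve 3 (λ e v d → e :* v :* d := d :* e :* v) refl e (v · v) d ⟩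
            d * e * (v · v)   ≈⟨ *-congʳ (*-inverseʳ-pos 0<d) ⟩
            1# * (v · v)      ≈⟨ *-identityˡ _ ⟩
            v · v             ≤⟨ bound v ⟩
            c * q             ≈⟨ +-identityˡ _ ⟨
            0# + c * q        ≤⟨ +-monoˡ-≤ (c * q) (0≤N v) ⟩
            q + c * q         ≈⟨ +-congʳ (*-identityˡ q) ⟨
            1# * q + c * q    ≈⟨ distribʳ q 1# c ⟨
            d * q             ≈⟨ *-comm d q ⟩
            q * d             ∎)
            where q = quadraticForm N v
          upper : IsUpperBound Rayleigh (s - e)
          upper t (v , 0<v·v , p) = *-cancelʳ-≤ (v · v) 0<v·v (begin
            t * (v · v)                      ≤⟨ p ⟩
            quadraticForm M v                ≈⟨ solve 2 (λ m s → m := s :- (s :- m)) refl (quadraticForm M v) (s * (v · v)) ⟩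
            s * (v · v) - (s * (v · v) - quadraticForm M v) ≈⟨ +-congˡ (-‿cong (N-form v)) ⟨
            s * (v · v) - quadraticForm N v  ≤⟨ 0≤y-x⇒x≤y (begin
              0# ≤⟨ x≤y⇒0≤y-x (ev²≤N v) ⟩
              quadraticForm N v - e * (v · v) ≈⟨ solve 4 (λ n e s v → n :- e :* v := (s :- e) :* v :- (s :* v :- n)) refl (quadraticForm N v) e s (v · v) ⟩
              (s - e) * (v · v) - (s * (v · v) - quadraticForm N v) ∎) ⟩
            (s - e) * (v · v)                ∎)

  -- The spectral theorem

  sum-single : ∀ {n} (j : Fin n) (f : Fin n → ℝ) → (∀ i → i ≢ j → f i ≈ 0#) → sum f ≈ f j
  sum-single j f f≈0 = trans (sum-cong δf≈f) (δ-identity f j)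
    where
    δf≈f : ∀ i → f i ≈ δ j i * f i
    δf≈f i with j ≟ i
    ... | yes _   = sym (*-identityˡ (f i))
    ... | no  j≢i = trans (f≈0 i λ i≡j → j≢i (≡.sym i≡j)) (sym (zeroˡ (f i)))

  Orthogonal : ∀ {n} → ℝ^ n → Subspace n → Set
  Orthogonal v W = ∀ w → W w → v · w ≈ 0#

  eigenspace-combination : ∀ {n} (M : Matrix n) {μ} c u v → Eigenspace M μ u → Eigenspace M μ v →
                           Eigenspace M μ (u ⊖ c ⊛ v)
  eigenspace-combination M {μ} c u v p q x = begin-equality
    M x · (u ⊖ c ⊛ v)          ≈⟨ ·-⊖ʳ (M x) u (c ⊛ v) ⟩
    M x · u - M x · (c ⊛ v)    ≈⟨ +-cong (p x) (-‿cong (trans (·-⊛ʳ c (M x) v) (*-congˡ (q x)))) ⟩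
    μ * u x - c * (μ * v x)    ≈⟨ solve 4 (λ m u c v → m :* u :- c :* (m :* v) := m :* (u :- c :* v)) refl μ (u x) c (v x) ⟩
    μ * (u x - c * v x)        ∎

  eigenspace-cong : ∀ {n} (M : Matrix n) {μ ν v} → μ ≈ ν → Eigenspace M μ v → Eigenspace M ν v
  eigenspace-cong M μ≈ν p x = trans (p x) (*-congʳ μ≈ν)

  eigenspaces-orthogonal : ∀ {n} {M : Matrix n} → IsSymmetric M → ∀ {μ ν} → μ ≉ ν →
                           ∀ u v → Eigenspace M μ u → Eigenspace M ν v → u · v ≈ 0#
  eigenspaces-orthogonal {M = M} M-sym {μ} {ν} μ≉ν u v p q =
    xy≈0⇒y≈0 (λ μ-ν≈0 → μ≉ν (x-y≈0⇒x≈y μ-ν≈0)) (begin-equality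
      (μ - ν) * (u · v)             ≈⟨ solve 3 (λ m n x → (m :- n) :* x := m :* x :- n :* x) refl μ ν (u · v) ⟩
      μ * (u · v) - ν * (u · v)     ≈⟨ +-cong (·-⊛ˡ μ u v) (-‿cong (·-⊛ʳ ν u v)) ⟨
      (μ ⊛ u) · v - u · (ν ⊛ v)     ≈⟨ +-cong (·-congʳ {v = v} p) (-‿cong (·-congˡ {u = u} q)) ⟨
      (M *ᵥ u) · v - u · (M *ᵥ v)   ≈⟨ +-congˡ (-‿cong (*ᵥ-symmetric {M = M} M-sym u v)) ⟩
      (M *ᵥ u) · v - (M *ᵥ u) · v   ≈⟨ -‿inverseʳ _ ⟩
      0#                            ∎)

  module Projection {n} (W : Subspace n) {P : Matrix n} (isProjection : IsOrthogonalProjection W P) where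
    open IsOrthogonalProjection isProjection

    pairing : ∀ v w → W w → v · w ≈ (P *ᵥ v) · w
    pairing v w w∈W = x-y≈0⇒x≈y (trans (sym (·-⊖ˡ v (P *ᵥ v) w)) (orthogonal v w w∈W))

    self-adjoint : ∀ u v → u · (P *ᵥ v) ≈ (P *ᵥ u) · v
    self-adjoint u v = begin-equality
      u · (P *ᵥ v)          ≈⟨ pairing u (P *ᵥ v) (image v) ⟩
      (P *ᵥ u) · (P *ᵥ v)   ≈⟨ ·-comm (P *ᵥ u) (P *ᵥ v) ⟩
      (P *ᵥ v) · (P *ᵥ u)   ≈⟨ pairing v (P *ᵥ u) (image u) ⟨
      v · (P *ᵥ u)          ≈⟨ ·-comm v (P *ᵥ u) ⟩
      (P *ᵥ u) · v          ∎

    symmetric : IsSymmetric P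
    symmetric x y = begin-equality
      P x y                  ≈⟨ entry x y ⟨
      δ x · (P *ᵥ δ y)       ≈⟨ self-adjoint (δ x) (δ y) ⟩
      (P *ᵥ δ x) · δ y       ≈⟨ ·-comm (P *ᵥ δ x) (δ y) ⟩
      δ y · (P *ᵥ δ x)       ≈⟨ entry y x ⟩
      P y x                  ∎
      where
      entry : ∀ x y → δ x · (P *ᵥ δ y) ≈ P x y
      entry x y = begin-equality
        δ x · (P *ᵥ δ y)  ≈⟨ δ-identity (P *ᵥ δ y) x ⟩
        P x · δ y         ≈⟨ ·-comm (P x) (δ y) ⟩
        δ y · P x         ≈⟨ δ-identity (P x) y ⟩
        P x y             ∎

    kills-orthogonal : ∀ v → Orthogonal v W → P *ᵥ v ≋ zeroVector
    kills-orthogonal v v⊥W = v·v≈0⇒v≋0 (P *ᵥ v) (trans (sym (pairing v (P *ᵥ v) (image v))) (v⊥W (P *ᵥ v) (image v)))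

  -- The difference v - Pv lies in the eigenspace and is orthogonal to it, hence to itself.
  -- Membership uses closure under subtraction, which a bare `Subspace` predicate does not provide;
  -- so this concerns eigenspaces only.
  fixes-eigenvectors : ∀ {n} {M P : Matrix n} {μ} → IsOrthogonalProjection (Eigenspace M μ) P →
                       ∀ v → Eigenspace M μ v → P *ᵥ v ≋ v
  fixes-eigenvectors {M = M} {P} {μ} isProjection v v∈W x = sym (x-y≈0⇒x≈y (v·v≈0⇒v≋0 (v ⊖ P *ᵥ v)
    (orthogonal v (v ⊖ P *ᵥ v) v-Pv∈W) x))
    where
    open IsOrthogonalProjection isProjection
    v-Pv∈W : Eigenspace M μ (v ⊖ P *ᵥ v)
    v-Pv∈W x = begin-equality
      M x · (v ⊖ P *ᵥ v)            ≈⟨ ·-⊖ʳ (M x) v (P *ᵥ v) ⟩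
      M x · v - M x · (P *ᵥ v)      ≈⟨ +-cong (v∈W x) (-‿cong (image v x)) ⟩
      μ * v x - μ * (P *ᵥ v) x      ≈⟨ solve 3 (λ m a b → m :* a :- m :* b := m :* (a :- b)) refl μ (v x) ((P *ᵥ v) x) ⟩
      μ * (v x - (P *ᵥ v) x)        ∎

  -- μ is a parameter so that the projections of a second matrix can be listed along the eigenvalues
  -- of a first one.
  record SpectralResolution {n} (M : Matrix n) {m} (μ : Fin m → ℝ) : Set where
    field
      M-symmetric  : IsSymmetric M
      μ-distinct   : ∀ {i j} → i ≢ j → μ i ≉ μ j
      μ-exhaustive : ∀ ν → IsEigenvalue M ν → ∃ λ i → ν ≈ μ i
      P            : Fin m → Matrix n
      P-projection : ∀ i → IsOrthogonalProjection (Eigenspace M (μ i)) (P i)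

    module P i = Projection (Eigenspace M (μ i)) (P-projection i)

    cross : ∀ {i j} → i ≢ j → ∀ v → Eigenspace M (μ j) v → P i *ᵥ v ≋ zeroVector
    cross {i} i≢j v v∈Wⱼ = P.kills-orthogonal i v λ w w∈Wᵢ →
      eigenspaces-orthogonal {M = M} M-symmetric (μ-distinct λ j≡i → i≢j (≡.sym j≡i)) v w v∈Wⱼ w∈Wᵢ

    OrthogonalToAll : ℝ^ n → Set
    OrthogonalToAll v = ∀ i → Orthogonal v (Eigenspace M (μ i))

    -- By `μ-exhaustive` a nonzero v would lie in one of the listed eigenspaces, and so be
    -- orthogonal to itself.
    no-eigenvector : ∀ s v → OrthogonalToAll v → Eigenspace M s v → v ≋ zeroVector
    no-eigenvector s v v⊥ v∈W with v ≋0?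
    ... | yes v≋0 = v≋0
    ... | no  v≉0 with μ-exhaustive s (v , v∈W , v≉0)
    ...   | i , s≈μ = v·v≈0⇒v≋0 v (v⊥ i v (eigenspace-cong M s≈μ v∈W))

    -- M with all its nonzero eigenvalues replaced by 0; it must vanish.
    deflated : Matrix n
    deflated x y = M x y - sum λ i → μ i * P i x y

    deflated-sym : IsSymmetric deflated
    deflated-sym x y = +-cong (M-symmetric x y) (-‿cong (sum-cong λ i → *-congˡ (P.symmetric i x y)))

    deflated-*ᵥ : ∀ v x → (deflated *ᵥ v) x ≈ (M *ᵥ v) x - sum λ i → μ i * (P i *ᵥ v) x
    deflated-*ᵥ v x = begin-equality
      deflated x · v                                            ≈⟨ ·-⊖ˡ (M x) (linearCombination μ Pₓ) v ⟩
      M x · v - linearCombination μ Pₓ · v                      ≈⟨ +-congˡ (-‿cong (trans (·-comm (linearCombination μ Pₓ) v) (·-linearCombination v μ Pₓ))) ⟩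
      M x · v - sum (λ i → μ i * (v · P i x))                   ≈⟨ +-congˡ (-‿cong (sum-cong λ i → *-congˡ (·-comm v (P i x)))) ⟩
      M x · v - sum (λ i → μ i * (P i x · v))                   ∎
      where
      Pₓ : Fin _ → ℝ^ n
      Pₓ i = P i x

    deflated-eigenspace : ∀ j w → Eigenspace M (μ j) w → deflated *ᵥ w ≋ zeroVector
    deflated-eigenspace j w w∈W x = begin-equality
      (deflated *ᵥ w) x                                   ≈⟨ deflated-*ᵥ w x ⟩
      (M *ᵥ w) x - sum (λ i → μ i * (P i *ᵥ w) x)         ≈⟨ +-cong (w∈W x) (-‿cong (trans
                                                               (sum-single j (λ i → μ i * (P i *ᵥ w) x) λ i i≢j → trans (*-congˡ (cross i≢j w w∈W x)) (zeroʳ (μ i)))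
                                                               (*-congˡ (fixes-eigenvectors {M = M} (P-projection j) w w∈W x)))) ⟩
      μ j * w x - μ j * w x                               ≈⟨ -‿inverseʳ _ ⟩
      0#                                                  ∎

    deflated-orthogonal : ∀ v → OrthogonalToAll v → deflated *ᵥ v ≋ M *ᵥ v
    deflated-orthogonal v v⊥ x = begin-equality
      (deflated *ᵥ v) x                                   ≈⟨ deflated-*ᵥ v x ⟩
      (M *ᵥ v) x - sum (λ i → μ i * (P i *ᵥ v) x)         ≈⟨ +-congˡ (-‿cong (sum-zero λ i → trans (*-congˡ (P.kills-orthogonal i v (v⊥ i) x)) (zeroʳ (μ i)))) ⟩
      (M *ᵥ v) x - 0#                                     ≈⟨ solve 1 (λ a → a :- con 0ℤ := a) refl _ ⟩
      (M *ᵥ v) x                                          ∎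

    -- Every eigenspace of M lies in the kernel of `deflated`, and by symmetry v is orthogonal to
    -- that kernel. On such vectors `deflated` agrees with M, so v is an eigenvector of M orthogonal
    -- to all eigenspaces.
    deflated-nonzero-eigenvalue : ∀ s v → s ≉ 0# → deflated *ᵥ v ≋ s ⊛ v → v ≋ zeroVector
    deflated-nonzero-eigenvalue s v s≉0 p = no-eigenvector s v v⊥ λ x →
      trans (sym (deflated-orthogonal v v⊥ x)) (p x)
      where
      v⊥ : OrthogonalToAll v
      v⊥ i w w∈W = xy≈0⇒y≈0 s≉0 (begin-equality
        s * (v · w)             ≈⟨ ·-⊛ˡ s v w ⟨
        (s ⊛ v) · w             ≈⟨ ·-congʳ {v = w} p ⟨
        (deflated *ᵥ v) · w     ≈⟨ *ᵥ-symmetric {M = deflated} deflated-sym v w ⟨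
        v · (deflated *ᵥ w)     ≈⟨ ·-zeroʳ v (deflated-eigenspace i w w∈W) ⟩
        0#                      ∎)

    -- Neither `deflated` nor its negative has a positive eigenvalue, so both forms are nonpositive.
    deflated-form : ∀ v → quadraticForm deflated v ≈ 0#
    deflated-form v = ≤-antisym
      (quadraticForm-nonpositive deflated deflated-sym (λ s v 0<s → deflated-nonzero-eigenvalue s v λ s≈0 → irrefl (sym s≈0) 0<s) v)
      (0≤y-x⇒x≤y (begin
        0#                                           ≤⟨ x≤y⇒0≤y-x (quadraticForm-nonpositive (λ x y → - deflated x y) (λ x y → -‿cong (deflated-sym x y)) negated v) ⟩
        0# - quadraticForm (λ x y → - deflated x y) v ≈⟨ +-congˡ (-‿cong (trans (·-congˡ {u = v} (neg-*ᵥ v)) (·-⊛ʳ (- 1#) v (deflated *ᵥ v)))) ⟩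
        0# - - 1# * quadraticForm deflated v          ≈⟨ solve 1 (λ q → con 0ℤ :- :- con 1ℤ :* q := q :- con 0ℤ) refl _ ⟩
        quadraticForm deflated v - 0#                 ∎))
      where
      neg-*ᵥ : ∀ v x → ((λ x y → - deflated x y) *ᵥ v) x ≈ - 1# * (deflated *ᵥ v) x
      neg-*ᵥ v x = trans (sum-cong λ y → solve 2 (λ d v → :- d :* v := :- con 1ℤ :* (d :* v)) refl (deflated x y) (v y)) (sum-*ˡ (- 1#) (λ y → deflated x y * v y))
      negated : ∀ s v → 0# < s → (λ x y → - deflated x y) *ᵥ v ≋ s ⊛ v → v ≋ zeroVector
      negated s v 0<s p = deflated-nonzero-eigenvalue (- s) v
        (λ -s≈0 → irrefl (begin-equality 0# ≈⟨ -0#≈0# ⟨ - 0# ≈⟨ -‿cong -s≈0 ⟨ - - s ≈⟨ solve 1 (λ s → :- :- s := s) refl s ⟩ s ∎) 0<s)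
        λ x → begin-equality
          (deflated *ᵥ v) x               ≈⟨ solve 1 (λ d → d := :- (:- con 1ℤ :* d)) refl _ ⟩
          - (- 1# * (deflated *ᵥ v) x)    ≈⟨ -‿cong (trans (sym (neg-*ᵥ v x)) (p x)) ⟩
          - (s * v x)                     ≈⟨ solve 2 (λ s v → :- (s :* v) := :- s :* v) refl s (v x) ⟩
          - s * v x                       ∎

    -- Polarisation of the vanishing quadratic form.
    deflated-vanishes : ∀ v → deflated *ᵥ v ≋ zeroVector
    deflated-vanishes v = v·v≈0⇒v≋0 w (≤-antisym (0≤y-x⇒x≤y (≤-trans (0≤v·v w) (≤-reflexive w·w≈0-w·w))) (0≤v·v w))
      where
      w : ℝ^ n
      w = deflated *ᵥ v
      w·w+w·w≈0 : w · w + w · w ≈ 0#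
      w·w+w·w≈0 = begin-equality
        w · w + w · w ≈⟨ solve 1 (λ x → x :+ x := con 0ℤ :+ x :+ (x :+ con 0ℤ)) refl (w · w) ⟩
        0# + w · w + (w · w + 0#) ≈⟨ +-cong (+-congʳ (deflated-form w)) (+-cong (*ᵥ-symmetric {M = deflated} deflated-sym v w) (deflated-form v)) ⟨
        quadraticForm deflated w + w · w + (v · (deflated *ᵥ w) + quadraticForm deflated v)
          ≈⟨ solve 4 (λ a b c d → a :+ b :+ (c :+ d) := a :+ c :+ (b :+ d)) refl _ _ _ _ ⟩
        quadraticForm deflated w + v · (deflated *ᵥ w) + (w · w + quadraticForm deflated v)
          ≈⟨ +-cong (·-⊕ˡ w v (deflated *ᵥ w)) (·-⊕ˡ w v (deflated *ᵥ v)) ⟨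
        (w ⊕ v) · (deflated *ᵥ w) + (w ⊕ v) · (deflated *ᵥ v) ≈⟨ ·-⊕ʳ (w ⊕ v) (deflated *ᵥ w) (deflated *ᵥ v) ⟨
        (w ⊕ v) · (deflated *ᵥ w ⊕ deflated *ᵥ v)             ≈⟨ ·-congˡ {u = w ⊕ v} (λ x → ·-⊕ʳ (deflated x) w v) ⟨
        quadraticForm deflated (w ⊕ v)                        ≈⟨ deflated-form (w ⊕ v) ⟩
        0# ∎
      -- Instead of halving: a nonnegative number equal to its own negative is zero.
      w·w≈0-w·w : w · w ≈ 0# - w · w
      w·w≈0-w·w = begin-equality
        w · w ≈⟨ solve 1 (λ x → x := x :+ x :- x) refl (w · w) ⟩
        w · w + w · w - w · w ≈⟨ +-congʳ w·w+w·w≈0 ⟩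
        0# - w · w ∎

    -- On v the matrix M agrees with `deflated`, which is zero; so v is an eigenvector for 0 unless
    -- it vanishes.
    orthogonal⇒zero : ∀ v → OrthogonalToAll v → v ≋ zeroVector
    orthogonal⇒zero v v⊥ = no-eigenvector 0# v v⊥ λ x →
      trans (sym (deflated-orthogonal v v⊥ x)) (trans (deflated-vanishes v x) (sym (zeroˡ (v x))))

    -- The difference of the two sides is orthogonal to every eigenspace: on the j-th one only the
    -- term of `P j` survives, and it pairs as v does.
    resolution : ∀ v x → v x ≈ sum λ i → (P i *ᵥ v) x
    resolution v x = x-y≈0⇒x≈y (trans (+-congˡ (-‿cong (sum-cong λ i → sym (*-identityˡ (Pv i x)))))
      (orthogonal⇒zero (v ⊖ linearCombination (λ _ → 1#) Pv) orth x))
      where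
      Pv : Fin _ → ℝ^ n
      Pv i = P i *ᵥ v
      orth : OrthogonalToAll (v ⊖ linearCombination (λ _ → 1#) Pv)
      orth j w w∈W = begin-equality
        (v ⊖ linearCombination (λ _ → 1#) Pv) · w   ≈⟨ ·-⊖ˡ v (linearCombination (λ _ → 1#) Pv) w ⟩
        v · w - linearCombination (λ _ → 1#) Pv · w ≈⟨ +-congˡ (-‿cong (trans (·-comm _ w) (·-linearCombination w (λ _ → 1#) Pv))) ⟩
        v · w - sum (λ i → 1# * (w · Pv i))         ≈⟨ +-congˡ (-‿cong (sum-single j (λ i → 1# * (w · Pv i)) λ i i≢j →
                                                         trans (*-identityˡ _) (trans (P.self-adjoint i w v) (trans (·-comm _ v) (·-zeroʳ v (cross i≢j w w∈W)))))) ⟩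
        v · w - 1# * (w · Pv j)                     ≈⟨ +-cong (P.pairing j v w w∈W) (-‿cong (trans (*-identityˡ _) (·-comm w (Pv j)))) ⟩
        Pv j · w - Pv j · w                         ≈⟨ -‿inverseʳ _ ⟩
        0#                                          ∎

  -- Dimensions

  module _ {n} {W W′ : Subspace n} (W⊆W′ : ∀ v → W v → W′ v) where

    dimension-⇔ : (∀ v → W′ v → W v) → ∀ {d} → HasDimension W d → HasDimension W′ d
    dimension-⇔ W′⊆W (b , isBasis) = b , record
      { member      = λ k → W⊆W′ (b k) (member k)
      ; independent = independent
      ; spanning    = λ v v∈W′ → spanning v (W′⊆W v v∈W′)
      }
      where open IsBasis isBasis

    -- The functional h vanishes on W and is 1 at u, so it reads off the coefficient of u; this
    -- gives independence, and v - (h·v) u is the component of v in W.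
    dimension-extend : ∀ (h u : ℝ^ n) → (∀ w → W w → h · w ≈ 0#) → W′ u → h · u ≈ 1# →
                       (∀ v → W′ v → W (v ⊖ (h · v) ⊛ u)) →
                       ∀ {d} → HasDimension W d → HasDimension W′ (suc d)
    dimension-extend h u h⊥W u∈W′ h·u≈1 reduce {d} (b , isBasis) = (u ◂ b) , record
      { member      = λ { zero → u∈W′ ; (suc k) → W⊆W′ (b k) (member k) }
      ; independent = λ { c p zero → head≈0 c p
                        ; c p (suc k) → independent (tail c) (λ x → begin-equality
                            linearCombination (tail c) b x                  ≈⟨ +-identityˡ _ ⟨
                            0# + linearCombination (tail c) b x             ≈⟨ +-congʳ (trans (*-congʳ (head≈0 c p)) (zeroˡ (u x))) ⟨
                            c zero * u x + linearCombination (tail c) b x   ≈⟨ p x ⟩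
                            0#                                              ∎) k }
      ; spanning    = λ v v∈W′ → let c , p = spanning (v ⊖ (h · v) ⊛ u) (reduce v v∈W′) in
          (h · v) ◂ c , λ x → begin-equality
            v x                                               ≈⟨ solve 2 (λ v w → v := w :+ (v :- w)) refl (v x) ((h · v) * u x) ⟩
            (h · v) * u x + (v x - (h · v) * u x)             ≈⟨ +-congˡ (p x) ⟩
            (h · v) * u x + linearCombination c b x           ∎
      }
      where
      open IsBasis isBasis
      head≈0 : ∀ c → linearCombination c (u ◂ b) ≋ zeroVector → c zero ≈ 0#
      head≈0 c p = begin-equality
        c zero                                                  ≈⟨ *-identityʳ _ ⟨
        c zero * 1#                                             ≈⟨ *-congˡ h·u≈1 ⟨
        c zero * (h · u)                                        ≈⟨ +-identityʳ _ ⟨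
        c zero * (h · u) + 0#                                   ≈⟨ +-congˡ (sum-zero {f = λ k → c (suc k) * (h · b k)} λ k →
                                                                     trans (*-congˡ (h⊥W (b k) (member k))) (zeroʳ (c (suc k)))) ⟨
        c zero * (h · u) + sum (λ k → c (suc k) * (h · b k))    ≈⟨ ·-linearCombination h c (u ◂ b) ⟨
        h · linearCombination c (u ◂ b)                         ≈⟨ ·-zeroʳ h p ⟩
        0#                                                      ∎

  sum-punchIn : ∀ {d} (j : Fin (suc d)) (f : Fin (suc d) → ℝ) → sum f ≈ f j + sum (λ i → f (punchIn j i))
  sum-punchIn j f = sum-remove {i = j} f

  -- Some basis vector b j has h · b j ≠ 0, for otherwise h · w = 0. Subtracting multiples of it
  -- brings the remaining basis vectors into the hyperplane. A combination of these with
  -- coefficients c is a combination of b whose j-th coefficient is -Σ cᵢ rᵢ, and h · v = 0 forces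
  -- exactly this coefficient. The existence of j makes d positive, so `pred` does not truncate.
  dimension-hyperplane : ∀ {n} {W : Subspace n} → (∀ c u v → W u → W v → W (u ⊖ c ⊛ v)) →
                         ∀ (h w : ℝ^ n) → W w → h · w ≉ 0# →
                         ∀ {d} → HasDimension W d → HasDimension (λ v → W v × h · v ≈ 0#) (pred d)
  dimension-hyperplane {n} {W} W-closed h w w∈W h·w≉0 {d} (b , isBasis) with any? (λ k → ¬? ((h · b k) ≟ᴿ 0#))
  ... | no ∄k = contradiction h·w≈0 h·w≉0
    where
    open IsBasis isBasis
    h·b≈0 : ∀ k → h · b k ≈ 0#
    h·b≈0 k with (h · b k) ≟ᴿ 0#
    ... | yes p = p
    ... | no ¬p = contradiction (k , ¬p) ∄k
    h·w≈0 : h · w ≈ 0#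
    h·w≈0 = let c , p = spanning w w∈W in begin-equality
      h · w                           ≈⟨ ·-congˡ {u = h} p ⟩
      h · linearCombination c b       ≈⟨ ·-linearCombination h c b ⟩
      sum (λ k → c k * (h · b k))     ≈⟨ sum-zero (λ k → trans (*-congˡ (h·b≈0 k)) (zeroʳ (c k))) ⟩
      0#                              ∎
  dimension-hyperplane {n} {W} W-closed h w w∈W h·w≉0 {suc d} (b , isBasis) | yes (j , hⱼ≉0) = b′ , record
    { member = λ i → W-closed (r i) (b (punchIn j i)) (b j) (member _) (member j) , (begin-equality
        h · b′ i                               ≈⟨ ·-⊖ʳ h (b (punchIn j i)) (r i ⊛ b j) ⟩
        a i - h · (r i ⊛ b j)                  ≈⟨ +-congˡ (-‿cong (·-⊛ʳ (r i) h (b j))) ⟩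
        a i - a i * g * (h · b j)              ≈⟨ solve 3 (λ a g h → a :- a :* g :* h := a :* (con 1ℤ :- h :* g)) refl (a i) g (h · b j) ⟩
        a i * (1# - (h · b j) * g)             ≈⟨ *-congˡ (trans (+-congˡ (-‿cong (*-inverseʳ hⱼ≉0))) (-‿inverseʳ 1#)) ⟩
        a i * 0#                               ≈⟨ zeroʳ (a i) ⟩
        0#                                     ∎)
    ; independent = λ c p i → trans (reflexive (≡.sym (insertAt-punchIn c j (coefficient c) i)))
        (independent (insertAt c j (coefficient c)) (λ x → trans (sym (expand c x)) (p x)) (punchIn j i))
    ; spanning = λ { v (v∈W , h·v≈0) → let c , p = spanning v v∈W in
        removeAt c j , λ x → begin-equality
          v x                                                    ≈⟨ p x ⟩
          linearCombination c b x                                ≈⟨ sum-punchIn j (λ k → c k * b k x) ⟩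
          c j * b j x + sum (λ i → c (punchIn j i) * b (punchIn j i) x)
            ≈⟨ +-congʳ (*-congʳ (pivot-coefficient c v p h·v≈0)) ⟩
          coefficient (removeAt c j) * b j x + sum (λ i → removeAt c j i * b (punchIn j i) x)
            ≈⟨ combine (removeAt c j) x ⟨
          linearCombination (removeAt c j) b′ x                  ∎ }
    }
    where
    open IsBasis isBasis
    open import Data.Integer.Base using (1ℤ)
    g = (h · b j) ⁻¹
    a r : ℝ^ d
    a i = h · b (punchIn j i)
    r i = a i * g
    b′ : Fin d → ℝ^ n
    b′ i = b (punchIn j i) ⊖ r i ⊛ b j
    coefficient : ℝ^ d → ℝ
    coefficient c = - sum (λ i → c i * r i)

    combine : ∀ c x → linearCombination c b′ x ≈ coefficient c * b j x + sum (λ i → c i * b (punchIn j i) x)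
    combine c x = begin-equality
      sum (λ i → c i * (b (punchIn j i) x - r i * b j x))
        ≈⟨ sum-cong (λ i → solve 4 (λ c b r y → c :* (b :- r :* y) := c :* b :- c :* r :* y) refl (c i) (b (punchIn j i) x) (r i) (b j x)) ⟩
      sum (λ i → c i * b (punchIn j i) x - c i * r i * b j x)
        ≈⟨ sum-- (λ i → c i * b (punchIn j i) x) (λ i → c i * r i * b j x) ⟩
      sum (λ i → c i * b (punchIn j i) x) - sum (λ i → c i * r i * b j x)
        ≈⟨ +-congˡ (-‿cong (sum-*ʳ (b j x) (λ i → c i * r i))) ⟩
      sum (λ i → c i * b (punchIn j i) x) - sum (λ i → c i * r i) * b j x
        ≈⟨ solve 3 (λ s t y → s :- t :* y := :- t :* y :+ s) refl _ _ (b j x) ⟩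
      coefficient c * b j x + sum (λ i → c i * b (punchIn j i) x) ∎

    expand : ∀ c x → linearCombination c b′ x ≈ linearCombination (insertAt c j (coefficient c)) b x
    expand c x = begin-equality
      linearCombination c b′ x                                              ≈⟨ combine c x ⟩
      coefficient c * b j x + sum (λ i → c i * b (punchIn j i) x)
        ≈⟨ +-cong (*-congʳ (reflexive (insertAt-lookup c j (coefficient c))))
                  (sum-cong λ i → *-congʳ (reflexive (insertAt-punchIn c j (coefficient c) i))) ⟨
      c⁺ j * b j x + sum (λ i → c⁺ (punchIn j i) * b (punchIn j i) x)       ≈⟨ sum-punchIn j (λ k → c⁺ k * b k x) ⟨
      linearCombination c⁺ b x                                              ∎
      where c⁺ = insertAt c j (coefficient c)

    pivot-coefficient : ∀ c v → v ≋ linearCombination c b → h · v ≈ 0# → c j ≈ coefficient (removeAt c j)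
    pivot-coefficient c v p h·v≈0 = x-y≈0⇒x≈y (begin-equality
      c j - - s                                       ≈⟨ solve 2 (λ c s → c :- :- s := c :* con 1ℤ :+ s) refl (c j) s ⟩
      c j * 1# + s                                    ≈⟨ +-cong (*-congˡ (sym (*-inverseʳ hⱼ≉0)))
                                                           (sum-cong λ i → sym (*-assoc (c (punchIn j i)) (a i) g)) ⟩
      c j * ((h · b j) * g) + sum (λ i → c (punchIn j i) * a i * g)
        ≈⟨ +-cong (sym (*-assoc (c j) (h · b j) g)) (sum-*ʳ g (λ i → c (punchIn j i) * a i)) ⟩
      c j * (h · b j) * g + sum (λ i → c (punchIn j i) * a i) * g ≈⟨ distribʳ g _ _ ⟨
      (c j * (h · b j) + sum (λ i → c (punchIn j i) * a i)) * g   ≈⟨ *-congʳ (sum-punchIn j (λ k → c k * (h · b k))) ⟨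
      sum (λ k → c k * (h · b k)) * g                 ≈⟨ *-congʳ (trans (·-congˡ {u = h} p) (·-linearCombination h c b)) ⟨
      (h · v) * g                                     ≈⟨ trans (*-congʳ h·v≈0) (zeroˡ g) ⟩
      0#                                              ∎)
      where s = sum (λ i → c (punchIn j i) * r i)

  -- If the first basis vector were zero, `δ zero` would be a nontrivial relation.
  dimension≢0⇒nonzero : ∀ {n} {W : Subspace n} {d} → d ≢ 0 → HasDimension W d → ∃ λ v → W v × ¬ (v ≋ zeroVector)
  dimension≢0⇒nonzero {d = zero}  d≢0 _ = contradiction ≡.refl d≢0
  dimension≢0⇒nonzero {d = suc d} _ (b , isBasis) = b zero , member zero , λ b₀≋0 →
    1≉0 (independent (δ zero) (λ x → trans (δ-identity (λ k → b k x) zero) (b₀≋0 x)) zero)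
    where open IsBasis isBasis

  nonzero⇒dimension≢0 : ∀ {n} {W : Subspace n} {d} → HasDimension W d → ∃ (λ v → W v × ¬ (v ≋ zeroVector)) → d ≢ 0
  nonzero⇒dimension≢0 (b , isBasis) (v , v∈W , v≉0) ≡.refl = v≉0 (proj₂ (IsBasis.spanning isBasis v v∈W))

  -- Finite sets of reals as lists

  multiplicity-accept : ∀ {x y} L → x ≈ y → multiplicity x (y ∷ L) ≡ suc (multiplicity x L)
  multiplicity-accept {x} L x≈y = ≡.cong length (filter-accept (x ≟ᴿ_) x≈y)

  multiplicity-reject : ∀ {x y} L → x ≉ y → multiplicity x (y ∷ L) ≡ multiplicity x L
  multiplicity-reject {x} L x≉y = ≡.cong length (filter-reject (x ≟ᴿ_) x≉y)

  multiplicity-++ : ∀ x L L′ → multiplicity x (L ++ L′) ≡ multiplicity x L ℕ.+ multiplicity x L′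
  multiplicity-++ x L L′ = ≡.trans (≡.cong length (filter-++ (x ≟ᴿ_) L L′)) (length-++ (filter (x ≟ᴿ_) L))

  multiplicity-map : ∀ (f : ℝ → ℝ) {x y} → (∀ {z} → x ≈ f z → y ≈ z) → (∀ {z} → y ≈ z → x ≈ f z) →
                     ∀ L → multiplicity x (map f L) ≡ multiplicity y L
  multiplicity-map f to from [] = ≡.refl
  multiplicity-map f {x} {y} to from (z ∷ L) with y ≟ᴿ z
  ... | yes y≈z = ≡.trans (multiplicity-accept (map f L) (from y≈z)) (≡.cong suc (multiplicity-map f to from L))
  ... | no  y≉z = ≡.trans (multiplicity-reject (map f L) λ p → y≉z (to p)) (multiplicity-map f to from L)

  -- A duplicate-free listing in terms of counts, because `IsSpectrum` sees a list only through its
  -- multiplicities.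
  Enumerates : Pred ℝ 0ℓ → List ℝ → Set
  Enumerates Q L = ∀ x → (Q x → multiplicity x L ≡ 1) × (¬ Q x → multiplicity x L ≡ 0)

  AtMostOne : Pred ℝ 0ℓ → Set
  AtMostOne Q = ∀ x y → Q x → Q y → x ≈ y

  -- The only possible element r of Q is found by testing the supremum of
  -- {a} ∪ Q, where a is a lower bound of Q: if r exists, then it is r.
  search-bounded : ∀ {Q} → Decidable Q → Q Respects _≈_ → AtMostOne Q →
                   ∀ {a b} → a ≤ b → (∀ x → Q x → a ≤ x × x ≤ b) → Dec (∃ Q)
  search-bounded {Q} Q? Q-resp unique {a} {b} a≤b bounded = decide (Q? s)
    where
    Candidate : Pred ℝ 0ℓ
    Candidate x = x ≈ a ⊎ Q x
    sup : ∃ λ s → IsUpperBound Candidate s × (∀ c → IsUpperBound Candidate c → s ≤ c)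
    sup = supremum Candidate (a , inj₁ refl) (b , λ
      { x (inj₁ x≈a) → ≤-trans (≤-reflexive x≈a) a≤b ; x (inj₂ Qx) → proj₂ (bounded x Qx) })
    s : ℝ
    s = proj₁ sup
    decide : Dec (Q s) → Dec (∃ Q)
    decide (yes Qs) = yes (s , Qs)
    decide (no ¬Qs) = no λ { (r , Qr) → ¬Qs (Q-resp (≤-antisym (proj₁ (proj₂ sup) r (inj₂ Qr))
      (proj₂ (proj₂ sup) r λ { x (inj₁ x≈a) → ≤-trans (≤-reflexive x≈a) (proj₁ (bounded r Qr))
                             ; x (inj₂ Qx) → ≤-reflexive (unique x r Qx Qr) })) Qr) }

  x²≤1⇒x≤1 : ∀ x → x * x ≤ 1# → x ≤ 1#
  x²≤1⇒x≤1 x x²≤1 = ≮⇒≥ λ 1<x → ≤⇒≯ x²≤1 (begin-strict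
    1#     <⟨ 1<x ⟩
    x      ≈⟨ *-identityˡ x ⟨
    1# * x <⟨ *-monoʳ-< x (<-trans 0<1 1<x) 1<x ⟩
    x * x  ∎)

  x²≤1⇒-1≤x : ∀ x → x * x ≤ 1# → - 1# ≤ x
  x²≤1⇒-1≤x x x²≤1 = 0≤y-x⇒x≤y (begin
    0#         ≤⟨ x≤y⇒0≤y-x (x²≤1⇒x≤1 (- x) (≤-trans (≤-reflexive (solve 1 (λ x → :- x :* :- x := x :* x) refl x)) x²≤1)) ⟩
    1# - - x   ≈⟨ solve 1 (λ x → con 1ℤ :- :- x := x :- :- con 1ℤ) refl x ⟩
    x - - 1#   ∎)

  ⁻¹-involutive : ∀ {x} → x ≉ 0# → x ⁻¹ ⁻¹ ≈ x
  ⁻¹-involutive {x} x≉0 = sym (⁻¹-unique (trans (*-comm (x ⁻¹) x) (*-inverseʳ x≉0)))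

  _≤?1 : ∀ x → Dec (x ≤ 1#)
  x ≤?1 with compare x 1#
  ... | tri< x<1 _ _ = yes (<⇒≤ x<1)
  ... | tri≈ _ x≈1 _ = yes (≤-reflexive x≈1)
  ... | tri> _ _ 1<x = no λ x≤1 → ≤⇒≯ x≤1 1<x

  -- An element outside [-1, 1] is searched through its inverse.
  search : ∀ {Q} → Decidable Q → Q Respects _≈_ → AtMostOne Q → Dec (∃ Q)
  search {Q} Q? Q-resp unique =
    decide (search-within Q Q? Q-resp unique) (search-within Q⁻¹ Q⁻¹? Q⁻¹-resp Q⁻¹-unique)
    where
    search-within : ∀ Q → Decidable Q → Q Respects _≈_ → AtMostOne Q → Dec (∃ λ x → x * x ≤ 1# × Q x)
    search-within Q Q? Q-resp unique = search-bounded
      (λ x → (x * x) ≤?1 ×-dec Q? x)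
      (λ { x≈y (p , q) → ≤-trans (≤-reflexive (*-cong (sym x≈y) (sym x≈y))) p , Q-resp x≈y q })
      (λ { x y (_ , p) (_ , q) → unique x y p q })
      (x²≤1⇒-1≤x 1# 1²≤1)
      (λ { x (p , _) → x²≤1⇒-1≤x x p , x²≤1⇒x≤1 x p })
      where
      1²≤1 : 1# * 1# ≤ 1#
      1²≤1 = ≤-reflexive (*-identityˡ 1#)
    Q⁻¹ : Pred ℝ 0ℓ
    Q⁻¹ t = t ≉ 0# × Q (t ⁻¹)
    Q⁻¹? : Decidable Q⁻¹
    Q⁻¹? t = ¬? (t ≟ᴿ 0#) ×-dec Q? (t ⁻¹)
    Q⁻¹-resp : Q⁻¹ Respects _≈_
    Q⁻¹-resp s≈t (s≉0 , p) = (λ t≈0 → s≉0 (trans s≈t t≈0)) , Q-resp (⁻¹-cong s≈t) p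
    Q⁻¹-unique : AtMostOne Q⁻¹
    Q⁻¹-unique s t (s≉0 , p) (t≉0 , q) =
      trans (sym (⁻¹-involutive s≉0)) (trans (⁻¹-cong (unique _ _ p q)) (⁻¹-involutive t≉0))
    large : ¬ (∃ λ t → t * t ≤ 1# × Q⁻¹ t) → ∀ x → Q x → ¬ ¬ (x * x ≤ 1#)
    large ∄large x Qx x²≰1 = ∄large (x ⁻¹ , t²≤1 , x≉0⇒x⁻¹≉0 x≉0 , Q-resp (sym (⁻¹-involutive x≉0)) Qx)
      where
      t = x ⁻¹
      x≉0 : x ≉ 0#
      x≉0 x≈0 = x²≰1 (≤-trans (≤-reflexive (trans (*-congʳ x≈0) (zeroˡ x))) (<⇒≤ 0<1))
      1≤x² : 1# ≤ x * x
      1≤x² = ≮⇒≥ λ x²<1 → x²≰1 (<⇒≤ x²<1)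
      t²≤1 : t * t ≤ 1#
      t²≤1 = begin
        t * t               ≈⟨ *-identityˡ _ ⟨
        1# * (t * t)        ≤⟨ *-monoʳ-≤ (t * t) (0≤x² t) 1≤x² ⟩
        x * x * (t * t)     ≈⟨ solve 2 (λ x t → x :* x :* (t :* t) := x :* t :* (x :* t)) refl x t ⟩
        x * t * (x * t)     ≈⟨ *-cong (*-inverseʳ x≉0) (*-inverseʳ x≉0) ⟩
        1# * 1#             ≈⟨ *-identityˡ 1# ⟩
        1#                  ∎
    decide : Dec (∃ λ x → x * x ≤ 1# × Q x) → Dec (∃ λ t → t * t ≤ 1# × Q⁻¹ t) → Dec (∃ Q)
    decide (yes (x , _ , Qx)) _                       = yes (x , Qx)
    decide (no _)             (yes (t , _ , _ , Qt⁻¹)) = yes (t ⁻¹ , Qt⁻¹)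
    decide (no ∄small)        (no ∄large)             = no λ { (x , Qx) →
      large ∄large x Qx (λ x²≤1 → ∄small (x , x²≤1 , Qx)) }

  SameSide : ℝ → ℝ → ℝ → Set
  SameSide x y p = (x < p × y < p) ⊎ (p < x × p < y)

  -- The points ps, in any order, cut the line into open cells, and Q has at most one element in
  -- each. Recursion splits Q at p: p itself is tested directly, the two sides inherit the remaining
  -- cuts. With no cuts left Q has at most one element, and `search` settles whether it has any.
  enumerate : ∀ ps {Q} → Decidable Q → Q Respects _≈_ →
              (∀ x y → Q x → Q y → All (SameSide x y) ps → x ≈ y) → ∃ (Enumerates Q)
  enumerate [] {Q} Q? Q-resp unique = listing (search Q? Q-resp λ x y Qx Qy → unique x y Qx Qy [])
    where
    listing : Dec (∃ Q) → ∃ (Enumerates Q)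
    listing (yes (r , Qr)) = [ r ] , λ x →
      (λ Qx → multiplicity-accept [] (unique x r Qx Qr [])) ,
      (λ ¬Qx → multiplicity-reject [] λ x≈r → ¬Qx (Q-resp (sym x≈r) Qr))
    listing (no ∄Q) = [] , λ x → (λ Qx → contradiction (x , Qx) ∄Q) , λ _ → ≡.refl
  enumerate (p ∷ ps) {Q} Q? Q-resp unique =
    below ++ (at ++ above) , λ x → case x (compare x p)
    where
    below,below-enum : ∃ (Enumerates λ x → x < p × Q x)
    below,below-enum = enumerate ps (λ x → (x <? p) ×-dec Q? x)
      (λ { x≈y (x<p , Qx) → <-respˡ-≈ x≈y x<p , Q-resp x≈y Qx })
      (λ { x y (x<p , Qx) (y<p , Qy) same → unique x y Qx Qy (inj₁ (x<p , y<p) ∷ same) })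
    above,above-enum : ∃ (Enumerates λ x → p < x × Q x)
    above,above-enum = enumerate ps (λ x → (p <? x) ×-dec Q? x)
      (λ { x≈y (p<x , Qx) → <-respʳ-≈ x≈y p<x , Q-resp x≈y Qx })
      (λ { x y (p<x , Qx) (p<y , Qy) same → unique x y Qx Qy (inj₂ (p<x , p<y) ∷ same) })
    below = proj₁ below,below-enum
    above = proj₁ above,above-enum
    at : List ℝ
    at with Q? p
    ... | yes _ = [ p ]
    ... | no  _ = []
    at-off : ∀ {x} → x ≉ p → multiplicity x at ≡ 0
    at-off x≉p with Q? p
    ... | yes _ = multiplicity-reject [] x≉p
    ... | no  _ = ≡.refl
    at-on : ∀ {x} → x ≈ p → (Q x → multiplicity x at ≡ 1) × (¬ Q x → multiplicity x at ≡ 0)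
    at-on x≈p with Q? p
    ... | yes Qp = (λ _ → multiplicity-accept [] x≈p) , (λ ¬Qx → contradiction (Q-resp (sym x≈p) Qp) ¬Qx)
    ... | no ¬Qp = (λ Qx → contradiction (Q-resp x≈p Qx) ¬Qp) , λ _ → ≡.refl
    count : ∀ {x k l m} → multiplicity x below ≡ k → multiplicity x at ≡ l → multiplicity x above ≡ m →
            multiplicity x (below ++ (at ++ above)) ≡ k ℕ.+ (l ℕ.+ m)
    count {x} k l m = ≡.trans (multiplicity-++ x below (at ++ above))
      (≡.cong₂ ℕ._+_ k (≡.trans (multiplicity-++ x at above) (≡.cong₂ ℕ._+_ l m)))
    case : ∀ x → Tri (x < p) (x ≈ p) (p < x) →
           (Q x → multiplicity x (below ++ (at ++ above)) ≡ 1) × (¬ Q x → multiplicity x (below ++ (at ++ above)) ≡ 0)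
    case x (tri< x<p x≉p x≯p) =
      (λ Qx → count (proj₁ (proj₂ below,below-enum x) (x<p , Qx)) (at-off x≉p) off) ,
      (λ ¬Qx → count (proj₂ (proj₂ below,below-enum x) λ { (_ , Qx) → ¬Qx Qx }) (at-off x≉p) off)
      where
      off : multiplicity x above ≡ 0
      off = proj₂ (proj₂ above,above-enum x) λ { (p<x , _) → x≯p p<x }
    case x (tri≈ x≮p x≈p x≯p) =
      (λ Qx → count belowOff (proj₁ (at-on x≈p) Qx) aboveOff) ,
      (λ ¬Qx → count belowOff (proj₂ (at-on x≈p) ¬Qx) aboveOff)
      where
      belowOff : multiplicity x below ≡ 0
      belowOff = proj₂ (proj₂ below,below-enum x) λ { (x<p , _) → x≮p x<p }
      aboveOff : multiplicity x above ≡ 0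
      aboveOff = proj₂ (proj₂ above,above-enum x) λ { (p<x , _) → x≯p p<x }
    case x (tri> x≮p x≉p p<x) =
      (λ Qx → count off (at-off x≉p) (proj₁ (proj₂ above,above-enum x) (p<x , Qx))) ,
      (λ ¬Qx → count off (at-off x≉p) (proj₂ (proj₂ above,above-enum x) λ { (_ , Qx) → ¬Qx Qx }))
      where
      off : multiplicity x below ≡ 0
      off = proj₂ (proj₂ below,below-enum x) λ { (x<p , _) → x≮p x<p }

  -- Multiset difference

  erase : ℝ → List ℝ → List ℝ
  erase p [] = []
  erase p (y ∷ L) with p ≟ᴿ y
  ... | yes _ = L
  ... | no  _ = y ∷ erase p L

  multiplicity-erase-≈ : ∀ {x p} → x ≈ p → ∀ L → multiplicity x (erase p L) ≡ pred (multiplicity x L)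
  multiplicity-erase-≈ x≈p [] = ≡.refl
  multiplicity-erase-≈ {x} {p} x≈p (y ∷ L) with p ≟ᴿ y
  ... | yes p≈y = ≡.sym (≡.cong pred (multiplicity-accept L (trans x≈p p≈y)))
  ... | no  p≉y = ≡.trans (multiplicity-reject (erase p L) x≉y)
                    (≡.trans (multiplicity-erase-≈ x≈p L) (≡.sym (≡.cong pred (multiplicity-reject L x≉y))))
    where
    x≉y : x ≉ y
    x≉y x≈y = p≉y (trans (sym x≈p) x≈y)

  multiplicity-erase-≉ : ∀ {x p} → x ≉ p → ∀ L → multiplicity x (erase p L) ≡ multiplicity x L
  multiplicity-erase-≉ x≉p [] = ≡.refl
  multiplicity-erase-≉ {x} {p} x≉p (y ∷ L) with p ≟ᴿ y
  ... | yes p≈y = ≡.sym (multiplicity-reject L λ x≈y → x≉p (trans x≈y (sym p≈y)))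
  ... | no  p≉y with x ≟ᴿ y
  ...   | yes x≈y = ≡.cong suc (multiplicity-erase-≉ x≉p L)
  ...   | no  x≉y = multiplicity-erase-≉ x≉p L

  infixl 5 _∖_
  _∖_ : List ℝ → List ℝ → List ℝ
  L ∖ []      = L
  L ∖ (p ∷ K) = erase p L ∖ K

  multiplicity-∖ : ∀ x L K → multiplicity x (L ∖ K) ≡ multiplicity x L ℕ.∸ multiplicity x K
  multiplicity-∖ x L []      = ≡.refl
  multiplicity-∖ x L (p ∷ K) with x ≟ᴿ p
  ... | yes x≈p = ≡.trans (multiplicity-∖ x (erase p L) K)
                    (≡.trans (≡.cong (ℕ._∸ multiplicity x K) (multiplicity-erase-≈ x≈p L)) (pred-∸ (multiplicity x L) (multiplicity x K)))
    where
    pred-∸ : ∀ a b → pred a ℕ.∸ b ≡ a ℕ.∸ suc b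
    pred-∸ zero    zero    = ≡.refl
    pred-∸ zero    (suc b) = ≡.refl
    pred-∸ (suc a) b       = ≡.refl
  ... | no  x≉p = ≡.trans (multiplicity-∖ x (erase p L) K) (≡.cong (ℕ._∸ multiplicity x K) (multiplicity-erase-≉ x≉p L))

  -- The spectrum of the complement

  module Secular {m} (μ β : Fin m → ℝ) (0≤β : ∀ i → 0# ≤ β i) where

    -- When βᵢ is the entry sum of Pᵢ, these are the main eigenvalues: those with an eigenvector not
    -- orthogonal to the all-ones vector.
    Pole : Pred ℝ 0ℓ
    Pole ν = ∃ λ i → β i ≉ 0# × ν ≈ μ i

    Pole? : Decidable Pole
    Pole? ν = any? λ i → ¬? (β i ≟ᴿ 0#) ×-dec (ν ≟ᴿ μ i)

    Pole-resp : Pole Respects _≈_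
    Pole-resp x≈y (i , βᵢ≉0 , x≈μ) = i , βᵢ≉0 , trans (sym x≈y) x≈μ

    sameSide⇒separated : ∀ {x y p} → SameSide x y p → 0# < (p - x) * (p - y)
    sameSide⇒separated (inj₁ (x<p , y<p)) = *-positive (x<y⇒0<y-x x<p) (x<y⇒0<y-x y<p)
    sameSide⇒separated {x} {y} {p} (inj₂ (p<x , p<y)) = begin-strict
      0#                   <⟨ *-positive (x<y⇒0<y-x p<x) (x<y⇒0<y-x p<y) ⟩
      (x - p) * (y - p)    ≈⟨ solve 3 (λ x y p → (x :- p) :* (y :- p) := (p :- x) :* (p :- y)) refl x y p ⟩
      (p - x) * (p - y)    ∎

    -- At ν = μᵢ the inverse takes its junk value and the i-th term is 0. This is right when βᵢ = 0;
    -- at a pole the value is meaningless, which is why `Root` excludes poles.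
    secular : ℝ → ℝ
    secular ν = sum λ i → β i * (μ i - ν) ⁻¹

    Root : Pred ℝ 0ℓ
    Root ν = ¬ Pole ν × secular ν ≈ 1#

    Root? : Decidable Root
    Root? ν = ¬? (Pole? ν) ×-dec (secular ν ≟ᴿ 1#)

    Root-resp : Root Respects _≈_
    Root-resp x≈y (¬pole , p) = (λ pole → ¬pole (Pole-resp (sym x≈y) pole)) ,
      trans (sum-cong λ i → *-congˡ {β i} (⁻¹-cong (+-congˡ (-‿cong (sym x≈y))))) p

    -- Between two poles the secular function is strictly monotone, because
    --   secular x − secular y = (x − y) Σᵢ βᵢ / ((μᵢ − x)(μᵢ − y)).
    Root-unique : ∀ x y → Root x → Root y → All (SameSide x y) (tabulate μ) → x ≈ y
    Root-unique x y (_ , fx≈1) (_ , fy≈1) same with (x - y) ≟ᴿ 0#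
    ... | yes x-y≈0 = x-y≈0⇒x≈y x-y≈0
    -- The slopes are nonnegative and sum to zero, so every βᵢ vanishes; then the secular function
    -- is 0 and never 1.
    ... | no  x-y≉0 = contradiction (trans (sym fx≈1) fx≈0) 1≉0
      where
      separated : ∀ i → 0# < (μ i - x) * (μ i - y)
      separated i = sameSide⇒separated (tabulate⁻ same i)
      slope : Fin m → ℝ
      slope i = β i * ((μ i - x) * (μ i - y)) ⁻¹
      difference : ∀ i → β i * (μ i - x) ⁻¹ - β i * (μ i - y) ⁻¹ ≈ (x - y) * slope i
      difference i = *-cancelˡ {a * b} ab≉0 (begin-equality
        a * b * (β i * a ⁻¹ - β i * b ⁻¹)
          ≈⟨ solve 5 (λ a b c i j → a :* b :* (c :* i :- c :* j) := a :* i :* (b :* c) :- b :* j :* (a :* c)) refl a b (β i) (a ⁻¹) (b ⁻¹) ⟩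
        a * a ⁻¹ * (b * β i) - b * b ⁻¹ * (a * β i)
          ≈⟨ +-cong (*-congʳ (*-inverseʳ a≉0)) (-‿cong (*-congʳ (*-inverseʳ b≉0))) ⟩
        1# * (b * β i) - 1# * (a * β i)
          ≈⟨ solve 4 (λ m x y c → con 1ℤ :* ((m :- y) :* c) :- con 1ℤ :* ((m :- x) :* c) := con 1ℤ :* ((x :- y) :* c)) refl (μ i) x y (β i) ⟩
        1# * ((x - y) * β i)                ≈⟨ *-congʳ (*-inverseʳ ab≉0) ⟨
        a * b * (a * b) ⁻¹ * ((x - y) * β i)
          ≈⟨ solve 4 (λ e i d c → e :* i :* (d :* c) := e :* (d :* (c :* i))) refl (a * b) ((a * b) ⁻¹) (x - y) (β i) ⟩
        a * b * ((x - y) * slope i) ∎)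
        where
        a = μ i - x
        b = μ i - y
        ab≉0 : a * b ≉ 0#
        ab≉0 p = irrefl (sym p) (separated i)
        a≉0 : a ≉ 0#
        a≉0 p = ab≉0 (trans (*-congʳ p) (zeroˡ b))
        b≉0 : b ≉ 0#
        b≉0 p = ab≉0 (trans (*-congˡ p) (zeroʳ a))
      Σslope≈0 : sum slope ≈ 0#
      Σslope≈0 = xy≈0⇒y≈0 x-y≉0 (begin-equality
        (x - y) * sum slope                               ≈⟨ *-distribˡ-sum (x - y) slope ⟩
        sum (λ i → (x - y) * slope i)                     ≈⟨ sum-cong difference ⟨
        sum (λ i → β i * (μ i - x) ⁻¹ - β i * (μ i - y) ⁻¹) ≈⟨ sum-- (λ i → β i * (μ i - x) ⁻¹) (λ i → β i * (μ i - y) ⁻¹) ⟩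
        secular x - secular y                             ≈⟨ +-cong fx≈1 (-‿cong fy≈1) ⟩
        1# - 1#                                           ≈⟨ -‿inverseʳ 1# ⟩
        0#                                                ∎)
      β≈0 : ∀ i → β i ≈ 0#
      β≈0 i = xy≈0⇒y≈0 (x≉0⇒x⁻¹≉0 λ p → irrefl (sym p) (separated i))
        (trans (*-comm _ (β i)) (nonneg-sum≈0 (λ i → *-nonneg (0≤β i) (<⇒≤ (0<x⇒0<x⁻¹ (separated i)))) Σslope≈0 i))
      fx≈0 : secular x ≈ 0#
      fx≈0 = sum-zero λ i → trans (*-congʳ (β≈0 i)) (zeroˡ ((μ i - x) ⁻¹))

    -- Vacuous: a pole equals some μᵢ, hence lies in no open cell, and all poles are found at the
    -- cut points.
    Pole-unique : ∀ x y → Pole x → Pole y → All (SameSide x y) (tabulate μ) → x ≈ y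
    Pole-unique x y (i , _ , x≈μ) _ same = contradiction (sameSide⇒separated (tabulate⁻ same i))
      (irrefl (sym (trans (*-congʳ (trans (+-congʳ (sym x≈μ)) (-‿inverseʳ x))) (zeroˡ _))))

    poles : ∃ (Enumerates Pole)
    poles = enumerate (tabulate μ) Pole? Pole-resp Pole-unique

    roots : ∃ (Enumerates Root)
    roots = enumerate (tabulate μ) Root? Root-resp Root-unique

    -- The spectrum of J − I − M for a matrix M with spectrum S.
    complementSpectrum : List ℝ → List ℝ
    complementSpectrum S = map (λ ν → - 1# - ν) ((S ∖ proj₁ poles) ++ proj₁ roots)

    multiplicity-complementSpectrum : ∀ S κ → let ν = - 1# - κ in ∀ {p r} →
      multiplicity ν (proj₁ poles) ≡ p → multiplicity ν (proj₁ roots) ≡ r →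
      multiplicity κ (complementSpectrum S) ≡ (multiplicity ν S ℕ.∸ p) ℕ.+ r
    multiplicity-complementSpectrum S κ {p} {r} p≡ r≡ =
      ≡.trans (multiplicity-map (λ ν → - 1# - ν)
                (λ {z} κ≈ → trans (+-congˡ (-‿cong κ≈)) (reflect z))
                (λ {z} ≈z → trans (sym (reflect κ)) (+-congˡ (-‿cong ≈z)))
                ((S ∖ proj₁ poles) ++ proj₁ roots))
      (≡.trans (multiplicity-++ ν (S ∖ proj₁ poles) (proj₁ roots))
        (≡.cong₂ ℕ._+_ (≡.trans (multiplicity-∖ ν S (proj₁ poles)) (≡.cong (multiplicity ν S ℕ.∸_) p≡)) r≡))
      where
      ν = - 1# - κ
      reflect : ∀ z → - 1# - (- 1# - z) ≈ z
      reflect = solve 1 (λ z → :- con 1ℤ :- (:- con 1ℤ :- z) := z) refl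

  -- Eigenspaces of the complement

  ones : ∀ {n} → ℝ^ n
  ones _ = 1#

  total : ∀ {n} → Matrix n → ℝ
  total M = sum λ x → sum λ y → M x y

  ones·M*ᵥones : ∀ {n} (M : Matrix n) → ones · (M *ᵥ ones) ≈ total M
  ones·M*ᵥones M = sum-cong λ x → trans (*-identityˡ (M x · ones)) (sum-cong λ y → *-identityʳ (M x y))

  -- Eigenspace (J − I − M) (−1 − ν)
  CoEigenspace : ∀ {n} → Matrix n → ℝ → Subspace n
  CoEigenspace M ν v = ∀ x → (M *ᵥ v) x - ν * v x ≈ ones · v

  module Complement {n} {M : Matrix n} {m} {μ : Fin m → ℝ} (resolved : SpectralResolution M μ) where
    open SpectralResolution resolved

    p : Fin m → ℝ^ n
    p i = P i *ᵥ ones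

    p∈W : ∀ i → Eigenspace M (μ i) (p i)
    p∈W i = IsOrthogonalProjection.image (P-projection i) ones

    p·p≈total : ∀ i → p i · p i ≈ total (P i)
    p·p≈total i = trans (sym (P.pairing i ones (p i) (p∈W i))) (ones·M*ᵥones (P i))

    0≤total : ∀ i → 0# ≤ total (P i)
    0≤total i = ≤-trans (0≤v·v (p i)) (≤-reflexive (p·p≈total i))

    -- β is given only up to `_≈_`, so that the totals of one graph can be used with the projections
    -- of another and `complementSpectrum` is the same term for both.
    module _ {β : Fin m → ℝ} (0≤β : ∀ i → 0# ≤ β i) (β≈total : ∀ i → β i ≈ total (P i))
             {S : List ℝ} (S-spectrum : IsSpectrum M S) where
      open Secular μ β 0≤β

      ones·p≈β : ∀ i → ones · p i ≈ β i
      ones·p≈β i = trans (ones·M*ᵥones (P i)) (sym (β≈total i))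

      β≈0⇒p≋0 : ∀ i → β i ≈ 0# → p i ≋ zeroVector
      β≈0⇒p≋0 i βᵢ≈0 = v·v≈0⇒v≋0 (p i) (trans (p·p≈total i) (trans (sym (β≈total i)) βᵢ≈0))

      eigen⇒difference : ∀ {ν v} → Eigenspace M ν v → ∀ x → (M *ᵥ v) x - ν * v x ≈ 0#
      eigen⇒difference v∈W x = trans (+-congʳ (v∈W x)) (-‿inverseʳ _)

      eigen⇒coEigen : ∀ {ν v} → Eigenspace M ν v → ones · v ≈ 0# → CoEigenspace M ν v
      eigen⇒coEigen v∈W 1·v≈0 x = trans (eigen⇒difference v∈W x) (sym 1·v≈0)

      coEigen⇒eigen : ∀ {ν v} → CoEigenspace M ν v → ones · v ≈ 0# → Eigenspace M ν v
      coEigen⇒eigen v∈W̄ 1·v≈0 x = x-y≈0⇒x≈y (trans (v∈W̄ x) 1·v≈0)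

      -- Pair (M - ν) v = (1·v) 1 with p k: the left side vanishes by symmetry and the right side is
      -- (1·v) β k, so 1·v = 0. What remains is the hyperplane 1·v = 0 of the eigenspace, and it
      -- misses p k.
      at-pole : ∀ ν → Pole ν → HasDimension (CoEigenspace M ν) (pred (multiplicity ν S))
      at-pole ν (k , βₖ≉0 , ν≈μₖ) = dimension-⇔ (λ { v (v∈W , 1·v≈0) → eigen⇒coEigen v∈W 1·v≈0 })
        (λ v v∈W̄ → coEigen⇒eigen v∈W̄ (sum≈0 v v∈W̄) , sum≈0 v v∈W̄)
        (dimension-hyperplane (eigenspace-combination M) ones (p k) pₖ∈W
          (λ 1·p≈0 → βₖ≉0 (trans (sym (ones·p≈β k)) 1·p≈0)) (S-spectrum ν))
        where
        pₖ∈W : Eigenspace M ν (p k)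
        pₖ∈W = eigenspace-cong M (sym ν≈μₖ) (p∈W k)
        sum≈0 : ∀ v → CoEigenspace M ν v → ones · v ≈ 0#
        sum≈0 v v∈W̄ = xy≈0⇒y≈0 βₖ≉0 (begin-equality
          β k * (ones · v)                            ≈⟨ *-congʳ (trans (·-comm (p k) ones) (ones·p≈β k)) ⟨
          (p k · ones) * (ones · v)                   ≈⟨ trans (*-comm _ _) (sym (·-⊛ʳ (ones · v) (p k) ones)) ⟩
          p k · ((ones · v) ⊛ ones)                   ≈⟨ ·-congˡ {u = p k} (λ x → trans (*-identityʳ _) (sym (v∈W̄ x))) ⟩
          p k · (M *ᵥ v ⊖ ν ⊛ v)                      ≈⟨ ·-⊖ʳ (p k) (M *ᵥ v) (ν ⊛ v) ⟩
          p k · (M *ᵥ v) - p k · (ν ⊛ v)              ≈⟨ +-cong (*ᵥ-symmetric {M = M} M-symmetric (p k) v) (-‿cong (·-⊛ʳ ν (p k) v)) ⟩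
          (M *ᵥ p k) · v - ν * (p k · v)              ≈⟨ +-congʳ (trans (·-congʳ {v = v} pₖ∈W) (·-⊛ˡ ν (p k) v)) ⟩
          ν * (p k · v) - ν * (p k · v)               ≈⟨ -‿inverseʳ _ ⟩
          0#                                          ∎)

      -- Away from the poles, u = (M − ν)⁻¹ ones satisfies ones · u = secular ν.
      module OffPoles (ν : ℝ) (¬pole : ¬ Pole ν) where

        g : Fin m → ℝ
        g i = (μ i - ν) ⁻¹

        u : ℝ^ n
        u = linearCombination g p

        off-pole : ∀ i → μ i ≈ ν → p i ≋ zeroVector
        off-pole i μᵢ≈ν with β i ≟ᴿ 0#
        ... | yes βᵢ≈0 = β≈0⇒p≋0 i βᵢ≈0
        ... | no  βᵢ≉0 = contradiction (i , βᵢ≉0 , sym μᵢ≈ν) ¬pole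

        -- Where μᵢ = ν there is nothing to invert, but p i = 0 because ν is no pole, and both sides
        -- vanish.
        cancel : ∀ i x → g i * (μ i - ν) * p i x ≈ p i x
        cancel i x with μ i ≟ᴿ ν
        ... | yes μ≈ν = trans (trans (*-congˡ pᵢx≈0) (zeroʳ _)) (sym pᵢx≈0)
          where
          pᵢx≈0 : p i x ≈ 0#
          pᵢx≈0 = off-pole i μ≈ν x
        ... | no  μ≉ν = trans (*-congʳ (trans (*-comm (g i) _) (*-inverseʳ λ μ-ν≈0 → μ≉ν (x-y≈0⇒x≈y μ-ν≈0)))) (*-identityˡ (p i x))

        M-ν-u : ∀ x → (M *ᵥ u) x - ν * u x ≈ 1#
        M-ν-u x = begin-equality
          M x · u - ν * u x
            ≈⟨ +-cong (·-linearCombination (M x) g p) (-‿cong (*-distribˡ-sum ν (λ i → g i * p i x))) ⟩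
          sum (λ i → g i * (M x · p i)) - sum (λ i → ν * (g i * p i x))
            ≈⟨ sum-- (λ i → g i * (M x · p i)) (λ i → ν * (g i * p i x)) ⟨
          sum (λ i → g i * (M x · p i) - ν * (g i * p i x))
            ≈⟨ sum-cong (λ i → begin-equality
                 g i * (M x · p i) - ν * (g i * p i x)     ≈⟨ +-congʳ (*-congˡ (p∈W i x)) ⟩
                 g i * (μ i * p i x) - ν * (g i * p i x)   ≈⟨ solve 4 (λ g m n q → g :* (m :* q) :- n :* (g :* q) := g :* (m :- n) :* q) refl (g i) (μ i) ν (p i x) ⟩
                 g i * (μ i - ν) * p i x                   ≈⟨ cancel i x ⟩
                 p i x                                     ∎) ⟩
          -- The spectral theorem enters here.
          sum (λ i → p i x)                                ≈⟨ resolution ones x ⟨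
          1#                                               ∎

        ones·u≈secular : ones · u ≈ secular ν
        ones·u≈secular = trans (·-linearCombination ones g p)
          (sum-cong λ i → trans (*-congˡ (ones·p≈β i)) (*-comm (g i) (β i)))

        -- If the eigenspace is nonzero, then ν is some μᵢ with p i = 0, and 1·w = p i · w.
        ones⊥W : ∀ w → Eigenspace M ν w → ones · w ≈ 0#
        ones⊥W w w∈W with w ≋0?
        ... | yes w≋0 = ·-zeroʳ ones w≋0
        ... | no  w≉0 with μ-exhaustive ν (w , w∈W , w≉0)
        ...   | i , ν≈μᵢ = begin-equality
          ones · w    ≈⟨ P.pairing i ones w (eigenspace-cong M ν≈μᵢ w∈W) ⟩
          p i · w     ≈⟨ ·-comm (p i) w ⟩
          w · p i     ≈⟨ ·-zeroʳ w (off-pole i (sym ν≈μᵢ)) ⟩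
          0#          ∎

        W⊆W̄ : ∀ w → Eigenspace M ν w → CoEigenspace M ν w
        W⊆W̄ w w∈W = eigen⇒coEigen w∈W (ones⊥W w w∈W)

        -- (M - ν) sends v to (1·v) 1 and u to 1. Since 1 is orthogonal to the resulting
        -- eigenvector, (1·v)(1 - secular ν) = 0: the coefficient of u is free at a root and zero
        -- elsewhere.
        reduce : ∀ v → CoEigenspace M ν v → Eigenspace M ν (v ⊖ (ones · v) ⊛ u)
        reduce v v∈W̄ x = x-y≈0⇒x≈y (begin-equality
          M x · (v ⊖ s ⊛ u) - ν * (v x - s * u x)
            ≈⟨ +-congʳ (trans (·-⊖ʳ (M x) v (s ⊛ u)) (+-congˡ (-‿cong (·-⊛ʳ s (M x) u)))) ⟩
          M x · v - s * (M x · u) - ν * (v x - s * u x)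
            ≈⟨ solve 6 (λ a s b n v u → a :- s :* b :- n :* (v :- s :* u) := (a :- n :* v) :- s :* (b :- n :* u)) refl (M x · v) s (M x · u) ν (v x) (u x) ⟩
          (M x · v - ν * v x) - s * (M x · u - ν * u x)
            ≈⟨ +-cong (v∈W̄ x) (-‿cong (trans (*-congˡ (M-ν-u x)) (*-identityʳ s))) ⟩
          s - s   ≈⟨ -‿inverseʳ s ⟩
          0#      ∎)
          where s = ones · v

        at-root : secular ν ≈ 1# → HasDimension (CoEigenspace M ν) (suc (multiplicity ν S))
        at-root f≈1 = dimension-extend W⊆W̄ ones u ones⊥W (λ x → trans (M-ν-u x) (sym ones·u≈1)) ones·u≈1 reduce (S-spectrum ν)
          where
          ones·u≈1 : ones · u ≈ 1#
          ones·u≈1 = trans ones·u≈secular f≈1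

        off-root : secular ν ≉ 1# → HasDimension (CoEigenspace M ν) (multiplicity ν S)
        off-root f≉1 = dimension-⇔ W⊆W̄ (λ v v∈W̄ → coEigen⇒eigen v∈W̄ (sum≈0 v v∈W̄)) (S-spectrum ν)
          where
          sum≈0 : ∀ v → CoEigenspace M ν v → ones · v ≈ 0#
          sum≈0 v v∈W̄ = xy≈0⇒y≈0 {1# - secular ν} (λ 1-f≈0 → f≉1 (sym (x-y≈0⇒x≈y 1-f≈0))) (begin-equality
            (1# - secular ν) * s    ≈⟨ solve 2 (λ f s → (con 1ℤ :- f) :* s := s :- s :* f) refl (secular ν) s ⟩
            s - s * secular ν       ≈⟨ +-congˡ (-‿cong (trans (·-⊛ʳ s ones u) (*-congˡ ones·u≈secular))) ⟨
            ones · v - ones · (s ⊛ u) ≈⟨ ·-⊖ʳ ones v (s ⊛ u) ⟨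
            ones · (v ⊖ s ⊛ u)      ≈⟨ ones⊥W (v ⊖ s ⊛ u) (reduce v v∈W̄) ⟩
            0#                      ∎)
            where s = ones · v

      coEigenspace-dimension : ∀ κ → HasDimension (CoEigenspace M (- 1# - κ)) (multiplicity κ (complementSpectrum S))
      coEigenspace-dimension κ = by-pole (Pole? ν)
        where
        ν = - 1# - κ
        from : ∀ {d p r} → multiplicity ν (proj₁ poles) ≡ p → multiplicity ν (proj₁ roots) ≡ r →
               d ≡ (multiplicity ν S ℕ.∸ p) ℕ.+ r → HasDimension (CoEigenspace M ν) d →
               HasDimension (CoEigenspace M ν) (multiplicity κ (complementSpectrum S))
        from p≡ r≡ d≡ = ≡.subst (HasDimension (CoEigenspace M ν)) (≡.trans d≡ (≡.sym (multiplicity-complementSpectrum S κ p≡ r≡)))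
        by-root : ¬ Pole ν → Dec (secular ν ≈ 1#) → HasDimension (CoEigenspace M ν) (multiplicity κ (complementSpectrum S))
        by-root ¬pole (yes f≈1) = from (proj₂ (proj₂ poles ν) ¬pole) (proj₁ (proj₂ roots ν) (¬pole , f≈1))
          (≡.sym (≡.trans (ℕ.+-suc (multiplicity ν S) 0) (≡.cong suc (ℕ.+-identityʳ _)))) (OffPoles.at-root ν ¬pole f≈1)
        by-root ¬pole (no f≉1) = from (proj₂ (proj₂ poles ν) ¬pole) (proj₂ (proj₂ roots ν) λ { (_ , f≈1) → f≉1 f≈1 })
          (≡.sym (ℕ.+-identityʳ _)) (OffPoles.off-root ν ¬pole f≉1)
        by-pole : Dec (Pole ν) → HasDimension (CoEigenspace M ν) (multiplicity κ (complementSpectrum S))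
        -- `pred` is by definition `_∸ 1`, the removal of the single copy of ν among the poles.
        by-pole (yes pole) = from (proj₁ (proj₂ poles ν) pole) (proj₂ (proj₂ roots ν) λ { (¬pole , _) → ¬pole pole })
          (≡.sym (ℕ.+-identityʳ _)) (at-pole ν pole)
        by-pole (no ¬pole) = by-root ¬pole (secular ν ≟ᴿ 1#)

      complement-spectrum : ∀ {C : Matrix n} → (∀ x y → C x y ≈ 1# - M x y - δ x y) →
                            IsSpectrum C (complementSpectrum S)
      complement-spectrum {C} C≈ κ = dimension-⇔ to from (coEigenspace-dimension κ)
        where
        C-*ᵥ : ∀ v x → (C *ᵥ v) x ≈ ones · v - (M *ᵥ v) x - v x
        C-*ᵥ v x = begin-equality
          C x · v                          ≈⟨ ·-congʳ {v = v} (C≈ x) ⟩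
          (ones ⊖ M x ⊖ δ x) · v           ≈⟨ ·-⊖ˡ (ones ⊖ M x) (δ x) v ⟩
          (ones ⊖ M x) · v - δ x · v       ≈⟨ +-cong (·-⊖ˡ ones (M x) v) (-‿cong (δ-identity v x)) ⟩
          ones · v - (M *ᵥ v) x - v x      ∎
        to : ∀ v → CoEigenspace M (- 1# - κ) v → Eigenspace C κ v
        to v v∈W̄ x = begin-equality
          (C *ᵥ v) x                                                    ≈⟨ C-*ᵥ v x ⟩
          ones · v - (M *ᵥ v) x - v x                                   ≈⟨ +-congʳ (+-congʳ (v∈W̄ x)) ⟨
          (M *ᵥ v) x - (- 1# - κ) * v x - (M *ᵥ v) x - v x
            ≈⟨ solve 3 (λ a k v → a :- (:- con 1ℤ :- k) :* v :- a :- v := k :* v) refl ((M *ᵥ v) x) κ (v x) ⟩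
          κ * v x                                                       ∎
        from : ∀ v → Eigenspace C κ v → CoEigenspace M (- 1# - κ) v
        from v v∈W x = begin-equality
          (M *ᵥ v) x - (- 1# - κ) * v x           ≈⟨ solve 3 (λ a k v → a :- (:- con 1ℤ :- k) :* v := k :* v :+ a :+ v) refl ((M *ᵥ v) x) κ (v x) ⟩
          κ * v x + (M *ᵥ v) x + v x              ≈⟨ +-congʳ (+-congʳ (trans (sym (v∈W x)) (C-*ᵥ v x))) ⟩
          ones · v - (M *ᵥ v) x - v x + (M *ᵥ v) x + v x
            ≈⟨ solve 3 (λ s a v → s :- a :- v :+ a :+ v := s) refl (ones · v) ((M *ᵥ v) x) (v x) ⟩
          ones · v                                ∎

  -- Comparison of two graphs

  Increasing : ∀ {m} → (Fin m → ℝ) → Set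
  Increasing μ = ∀ i j → i Fin.< j → μ i < μ j

  increasing⇒distinct : ∀ {m} {μ : Fin m → ℝ} → Increasing μ → ∀ {i j} → i ≢ j → μ i ≉ μ j
  increasing⇒distinct μ-inc {i} {j} i≢j μᵢ≈μⱼ with <-cmp i j
  ... | tri< i<j _ _ = irrefl μᵢ≈μⱼ (μ-inc i j i<j)
  ... | tri≈ _ i≡j _ = i≢j i≡j
  ... | tri> _ _ j<i = irrefl (sym μᵢ≈μⱼ) (μ-inc j i j<i)

  increasing⇒injective : ∀ {m} {μ : Fin m → ℝ} → Increasing μ → ∀ {i j} → μ i ≈ μ j → i ≡ j
  increasing⇒injective μ-inc {i} {j} μᵢ≈μⱼ with i ≟ j
  ... | yes i≡j = i≡j
  ... | no  i≢j = contradiction μᵢ≈μⱼ (increasing⇒distinct μ-inc i≢j)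

  increasing⇒reflects : ∀ {m} {μ : Fin m → ℝ} → Increasing μ → ∀ {i j} → μ i < μ j → i Fin.< j
  increasing⇒reflects μ-inc {i} {j} μᵢ<μⱼ with <-cmp i j
  ... | tri< i<j _ _ = i<j
  ... | tri≈ _ ≡.refl _ = contradiction μᵢ<μⱼ (irrefl refl)
  ... | tri> _ _ j<i = contradiction (<-trans μᵢ<μⱼ (μ-inc j i j<i)) (irrefl refl)

  monotone⇒inflationary : ∀ {m m′} (φ : Fin m → Fin m′) → (∀ i j → i Fin.< j → φ i Fin.< φ j) →
                          ∀ i → toℕ i ℕ.≤ toℕ (φ i)
  monotone⇒inflationary {suc m} φ φ-mono = <-weakInduction (λ i → toℕ i ℕ.≤ toℕ (φ i)) ℕ.z≤n λ i i≤φi →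
    ℕ.≤-<-trans (≡.subst (ℕ._≤ toℕ (φ (inject₁ i))) (toℕ-inject₁ i) i≤φi)
      (φ-mono (inject₁ i) (suc i) (ℕ.s≤s (ℕ.≤-reflexive (toℕ-inject₁ i))))

  reindex-inflationary : ∀ {m m′} {μ : Fin m → ℝ} {μ′ : Fin m′ → ℝ} → Increasing μ → Increasing μ′ →
                         (f : ∀ i → ∃ λ j → μ i ≈ μ′ j) → ∀ i → toℕ i ℕ.≤ toℕ (proj₁ (f i))
  reindex-inflationary μ-inc μ′-inc f = monotone⇒inflationary (λ i → proj₁ (f i)) λ i j i<j →
    increasing⇒reflects μ′-inc (<-respʳ-≈ (proj₂ (f j)) (<-respˡ-≈ (proj₂ (f i)) (μ-inc i j i<j)))

  -- Profile entries are addressed by position, so an eigenvalue must have the same position in both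
  -- graphs. The two reindexings are strictly monotone, hence inflationary, and mutually inverse: i
  -- ≤ f i ≤ g (f i) = i. Positions are compared by `toℕ` because m and m′ are not known to
  -- coincide.
  reindex-trivial : ∀ {m m′} {μ : Fin m → ℝ} {μ′ : Fin m′ → ℝ} → Increasing μ → Increasing μ′ →
                    (f : ∀ i → ∃ λ j → μ i ≈ μ′ j) → (∀ j → ∃ λ i → μ′ j ≈ μ i) →
                    ∀ i → toℕ (proj₁ (f i)) ≡ toℕ i
  reindex-trivial {μ = μ} μ-inc μ′-inc f g i = ℕ.≤-antisym
    (≡.subst (λ k → toℕ j ℕ.≤ toℕ k) gj≡i (reindex-inflationary μ′-inc μ-inc g j))
    (reindex-inflationary μ-inc μ′-inc f i)
    where
    j = proj₁ (f i)
    gj≡i : proj₁ (g j) ≡ i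
    gj≡i = increasing⇒injective μ-inc (sym (trans (proj₂ (f i)) (proj₂ (g j))))

  -- Entry sums of the projections, read off the profile

  Profile : Set
  Profile = Setoid.Carrier ProfileSetoid

  -- Total, with default `0#`, because the tuples of two graphs are lists of lengths not known to be
  -- equal. The positions read below are in range.
  entry : ℕ → List ℝ → ℝ
  entry _       []      = 0#
  entry zero    (x ∷ _) = x
  entry (suc k) (_ ∷ l) = entry k l

  entry-cong : ∀ k {l l′} → Setoid._≈_ TupleSetoid l l′ → entry k l ≈ entry k l′
  entry-cong _       []      = refl
  entry-cong zero    (p ∷ _) = p
  entry-cong (suc k) (_ ∷ q) = entry-cong k q

  entry-tabulate : ∀ {m} (f : Fin m → ℝ) i → entry (toℕ i) (tabulate f) ≡ f i
  entry-tabulate f zero    = ≡.refl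
  entry-tabulate f (suc i) = entry-tabulate (λ j → f (suc j)) i

  sumOver : ∀ {a} {A : Set a} → (A → ℝ) → List A → ℝ
  sumOver g l = foldr _+_ 0# (map g l)

  sumOver-tabulate : ∀ {a} {A : Set a} (g : A → ℝ) {n} (f : Fin n → A) →
                     sumOver g (tabulate f) ≡ sum λ i → g (f i)
  sumOver-tabulate g {zero}  f = ≡.refl
  sumOver-tabulate g {suc n} f = ≡.cong (g (f zero) +_) (sumOver-tabulate g λ i → f (suc i))

  sumOver-↭ : ∀ A {g : Setoid.Carrier A → ℝ} → (∀ {x y} → Setoid._≈_ A x y → g x ≈ g y) →
              ∀ {l l′} → Setoid._≈_ (MultisetSetoid A) l l′ → sumOver g l ≈ sumOver g l′
  sumOver-↭ A g-cong p = Permutation.foldr-commMonoid setoid +-isCommutativeMonoid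
    (Permutation.map⁺ A setoid g-cong p)

  -- A sum of row sums is insensitive both to the order of the rows and to the order within each
  -- row, which is just the freedom left by equality of profiles.
  profileTotal : ℕ → Profile → ℝ
  profileTotal k = sumOver λ { (_ , l) → sumOver (entry k) l }

  profileTotal-cong : ∀ k {T T′} → Setoid._≈_ ProfileSetoid T T′ → profileTotal k T ≈ profileTotal k T′
  profileTotal-cong k = sumOver-↭ (×-setoid TupleSetoid (MultisetSetoid TupleSetoid))
    λ { (_ , p) → sumOver-↭ TupleSetoid (entry-cong k) p }

  profileTotal-profile : ∀ {n} {M : Matrix n} (E : Eigenprojections M) i →
                         profileTotal (toℕ i) (profile E) ≈ total (Eigenprojections.P E i)
  profileTotal-profile E i = trans
    (reflexive (sumOver-tabulate _ λ x → P* x x , tabulate λ y → P* x y))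
    (sum-cong λ x → trans (reflexive (sumOver-tabulate (entry (toℕ i)) λ y → P* x y))
      (sum-cong λ y → reflexive (entry-tabulate (λ j → P j x y) i)))
    where open Eigenprojections E

  multiplicity-↭ : ∀ ν {S S′} → Setoid._≈_ (MultisetSetoid setoid) S S′ → multiplicity ν S ≡ multiplicity ν S′
  multiplicity-↭ ν p = Permutation.xs↭ys⇒|xs|≡|ys| setoid
    (Permutation.filter⁺ setoid (ν ≟ᴿ_) (λ x≈y ν≈x → trans ν≈x x≈y) p)

  -- Eigenvalues are recognised in the spectrum by nonzero multiplicity, so cospectral matrices
  -- share them.
  spectrum⇒eigenvalue : ∀ {n n′} {M : Matrix n} {M′ : Matrix n′} {S} → IsSpectrum M S → IsSpectrum M′ S →
                        ∀ ν → IsEigenvalue M ν → IsEigenvalue M′ ν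
  spectrum⇒eigenvalue M-spec M′-spec ν e = dimension≢0⇒nonzero (nonzero⇒dimension≢0 (M-spec ν) e) (M′-spec ν)

  adjacency-symmetric : ∀ G → IsSymmetric (adjacencyMatrix G)
  adjacency-symmetric G x y rewrite Graph.adj-sym G x y = refl

  adjacency-complement : ∀ G x y → adjacencyMatrix (complement G) x y ≈ 1# - adjacencyMatrix G x y - δ x y
  adjacency-complement G x y with x ≟ y
  ... | yes ≡.refl rewrite Graph.adj-irrefl G x = solve 0 (con 0ℤ := con 1ℤ :- con 0ℤ :- con 1ℤ) refl
  ... | no _ with Graph.adj G x y
  ...   | true  = solve 0 (con 0ℤ := con 1ℤ :- con 1ℤ :- con 0ℤ) refl
  ...   | false = solve 0 (con 1ℤ := con 1ℤ :- con 0ℤ :- con 0ℤ) refl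

  projection-cong : ∀ {n} (M : Matrix n) {P μ ν} → μ ≈ ν →
                    IsOrthogonalProjection (Eigenspace M μ) P → IsOrthogonalProjection (Eigenspace M ν) P
  projection-cong M μ≈ν isProjection = record
    { image      = λ v → eigenspace-cong M μ≈ν (image v)
    ; orthogonal = λ v w w∈W → orthogonal v w (eigenspace-cong M (sym μ≈ν) w∈W)
    }
    where open IsOrthogonalProjection isProjection

  genSpec≼Fweak : (G H : Graph) → Agree Fweak G H →
                  Agree Spec G H × Agree Spec (complement G) (complement H)
  genSpec≼Fweak G H ((S , T) , (S′ , T′) , (G-spec , E , T≈) , (H-spec , E′ , T′≈) , S≈S′ , T≈T′) =
    (S , S′ , G-spec , H-spec , S≈S′) ,
    -- One list, built from the data of G, is shown to be the spectrum of both complements, so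
    -- agreement is reflexivity.
    (S̄ , S̄ , Complement.complement-spectrum resolvedᴳ 0≤β (λ _ → refl) G-spec (adjacency-complement G)
           , Complement.complement-spectrum resolvedᴴ 0≤β β≈totalᴴ H-spec′ (adjacency-complement H)
           , Setoid.refl (MultisetSetoid setoid))
    where
    module E = Eigenprojections E
    module E′ = Eigenprojections E′

    H-spec′ : IsSpectrum (adjacencyMatrix H) S
    H-spec′ ν = ≡.subst (HasDimension _) (≡.sym (multiplicity-↭ ν S≈S′)) (H-spec ν)

    φ : ∀ i → ∃ λ j → E.μ i ≈ E′.μ j
    φ i = E′.μ-exhaustive (E.μ i) (spectrum⇒eigenvalue {S = S} G-spec H-spec′ (E.μ i) (E.μ-eigenvalue i))

    ψ : ∀ j → ∃ λ i → E′.μ j ≈ E.μ i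
    ψ j = E.μ-exhaustive (E′.μ j) (spectrum⇒eigenvalue {S = S} H-spec′ G-spec (E′.μ j) (E′.μ-eigenvalue j))

    resolvedᴳ : SpectralResolution (adjacencyMatrix G) E.μ
    resolvedᴳ = record
      { M-symmetric  = adjacency-symmetric G
      ; μ-distinct   = increasing⇒distinct E.μ-increasing
      ; μ-exhaustive = E.μ-exhaustive
      ; P            = E.P
      ; P-projection = E.P-projection
      }

    -- The projections of H are relisted along the eigenvalues of G, which makes the same instance
    -- of `Secular` apply to both graphs.
    resolvedᴴ : SpectralResolution (adjacencyMatrix H) E.μ
    resolvedᴴ = record
      { M-symmetric  = adjacency-symmetric H
      ; μ-distinct   = increasing⇒distinct E.μ-increasing
      ; μ-exhaustive = λ ν e → E.μ-exhaustive ν (spectrum⇒eigenvalue {S = S} H-spec′ G-spec ν e)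
      ; P            = λ i → E′.P (proj₁ (φ i))
      ; P-projection = λ i → projection-cong (adjacencyMatrix H) (sym (proj₂ (φ i))) (E′.P-projection (proj₁ (φ i)))
      }

    β : Fin E.m → ℝ
    β i = total (E.P i)

    0≤β : ∀ i → 0# ≤ β i
    0≤β = Complement.0≤total resolvedᴳ

    profile≈ : Setoid._≈_ ProfileSetoid (profile E) (profile E′)
    profile≈ = Setoid.trans ProfileSetoid (Setoid.sym ProfileSetoid T≈) (Setoid.trans ProfileSetoid T≈T′ T′≈)

    β≈totalᴴ : ∀ i → β i ≈ total (E′.P (proj₁ (φ i)))
    β≈totalᴴ i = begin-equality
      total (E.P i)                               ≈⟨ profileTotal-profile E i ⟨
      profileTotal (toℕ i) (profile E)            ≈⟨ profileTotal-cong (toℕ i) profile≈ ⟩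
      profileTotal (toℕ i) (profile E′)           ≡⟨ ≡.cong (λ k → profileTotal k (profile E′)) (reindex-trivial E.μ-increasing E′.μ-increasing φ ψ i) ⟨
      profileTotal (toℕ (proj₁ (φ i))) (profile E′) ≈⟨ profileTotal-profile E′ (proj₁ (φ i)) ⟩
      total (E′.P (proj₁ (φ i)))                  ∎

    S̄ : List ℝ
    S̄ = Secular.complementSpectrum E.μ β 0≤β S

theorem5p4 : (R : Reals) → let open Spectra R in
    (G H : Graph) → Agree Fweak G H →
    Agree Spec G H × Agree Spec (complement G) (complement H)
theorem5p4 = genSpec≼Fweak
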